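{- Let $\mathcal{L}\in\{\mathtt{M},\mathtt{ME},\mathtt{ME}^\infty\}$, let $B\subseteq A$ and let $\phi$ be a sentence of $\mathcal{L}(A)$. Then $\phi$ is monotone in $B$ if and only if $\phi$ is equivalent to some $B$-positive sentence of $\mathcal{L}(A)$. Furthermore, it is decidable whether a given sentence $\phi\in\mathcal{L}(A)$ is monotone in $B$.
   Context: Fix a finite set $A$ of monadic predicate symbols. A monadic model is a pair $(D,V)$ with $D$ a set (the empty set is allowed) and $V:A\to\wp(D)$. Formulas of $\mathtt{ME}^\infty(A)$ are given by the grammar $\varphi::=\top\mid\bot\mid a(x)\mid\neg a(x)\mid x\approx y\mid x\not\approx y\mid\varphi\vee\varphi\mid\varphi\wedge\varphi\mid\exists x.\varphi\mid\forall x.\varphi\mid\exists^\infty x.\varphi\mid\forall^\infty x.\varphi$ with $a\in A$ and $x,y$ individual variables. $\mathtt{ME}(A)$ is the fragment without $\exists^\infty,\forall^\infty$, and $\mathtt{M}(A)$ is the fragment of $\mathtt{ME}(A)$ without the atoms $x\approx y$, $x\not\approx y$. A sentence is a formula without free variables. On a nonempty model truth under an assignment is standard, where $\exists^\infty x.\varphi$ holds iff infinitely many elements satisfy $\varphi$ and $\forall^\infty x.\varphi$ holds iff all but at most finitely many elements satisfy $\varphi$. On the empty model, sentences $\exists x.\varphi$ and $\exists^\infty x.\varphi$ are false, $\forall x.\varphi$ and $\forall^\infty x.\varphi$ are true, and Boolean connectives are interpreted as usual. Sentences are equivalent if true in exactly the same models. For valuations $V,V'$ on the same domain $D$, write $V\le_B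 V'$ if $V(b)\subseteq V'(b)$ for all $b\in B$ and $V(a)=V'(a)$ for all $a\in A\setminus B$. A formula $\phi$ is monotone in $B$ if $(D,V),g\models\phi$ and $V\le_B V'$ imply $(D,V'),g\models\phi$ for all models and assignments $g$. The $B$-positive formulas of $\mathcal{L}(A)$ for $\mathcal{L}\in\{\mathtt{M},\mathtt{ME}\}$ are generated by $\phi::=\psi\mid b(x)\mid\phi\wedge\phi\mid\phi\vee\phi\mid\exists x.\phi\mid\forall x.\phi$ where $b\in B$ and $\psi\in\mathcal{L}(A\setminus B)$; for $\mathtt{ME}^\infty$ the grammar additionally has $\exists^\infty x.\phi$ and $\forall^\infty x.\phi$, with $\psi\in\mathtt{ME}^\infty(A\setminus B)$. -}

module Defs where

open import Level using (0ℓ)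
open import Data.Nat using (ℕ; suc)
open import Data.Fin using (Fin; zero; suc)
open import Data.Fin.Subset using (Subset; _∈_; _∉_)
open import Data.Bool using (Bool; true; false)
open import Data.List using (List)
open import Data.List.Membership.Propositional using () renaming (_∈_ to _∈L_)
open import Data.Product using (Σ; _×_; _,_)
open import Data.Sum using (_⊎_)
open import Data.Unit using (⊤)
open import Data.Empty using (⊥)
open import Relation.Nullary using (¬_)
open import Relation.Binary.PropositionalEquality using (_≡_; _≢_)

-- Formulas of ME^∞(A), A = Fin k, with de Bruijn variables: Fm k n has
-- its free variables among Fin n.  Sentences are Fm k 0.
data Fm (k n : ℕ) : Set where
  tt ff        : Fm k n
  pos neg      : Fin k → Fin n → Fm k n
  eq neq       : Fin n → Fin n → Fm k n
  _∨'_ _∧'_    : Fm k n → Fm k n → Fm k n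
  ex all       : Fm k (suc n) → Fm k n
  exinf allinf : Fm k (suc n) → Fm k n

Sentence : ℕ → Set
Sentence k = Fm k 0

data Logic : Set where
  M ME MEinf : Logic

allowsEq : Logic → Bool
allowsEq M = false
allowsEq ME = true
allowsEq MEinf = true

allowsInf : Logic → Bool
allowsInf MEinf = true
allowsInf _ = false

IsTrue : Bool → Set
IsTrue true = ⊤
IsTrue false = ⊥

In : ∀ {k n} → Logic → Fm k n → Set
In L tt = ⊤
In L ff = ⊤
In L (pos a x) = ⊤
In L (neg a x) = ⊤
In L (eq x y) = IsTrue (allowsEq L)
In L (neq x y) = IsTrue (allowsEq L)
In L (φ ∨' ψ) = In L φ × In L ψ
In L (φ ∧' ψ) = In L φ × In L ψ
In L (ex φ) = In L φ
In L (all φ) = In L φ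
In L (exinf φ) = IsTrue (allowsInf L) × In L φ
In L (allinf φ) = IsTrue (allowsInf L) × In L φ

AvoidsB : ∀ {k n} → Subset k → Fm k n → Set
AvoidsB B tt = ⊤
AvoidsB B ff = ⊤
AvoidsB B (pos a x) = a ∉ B
AvoidsB B (neg a x) = a ∉ B
AvoidsB B (eq x y) = ⊤
AvoidsB B (neq x y) = ⊤
AvoidsB B (φ ∨' ψ) = AvoidsB B φ × AvoidsB B ψ
AvoidsB B (φ ∧' ψ) = AvoidsB B φ × AvoidsB B ψ
AvoidsB B (ex φ) = AvoidsB B φ
AvoidsB B (all φ) = AvoidsB B φ
AvoidsB B (exinf φ) = AvoidsB B φ
AvoidsB B (allinf φ) = AvoidsB B φ

data Positive {k : ℕ} (L : Logic) (B : Subset k) : {n : ℕ} → Fm k n → Set where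
  base   : ∀ {n} {ψ : Fm k n} → In L ψ → AvoidsB B ψ → Positive L B ψ
  atom   : ∀ {n} {b : Fin k} {x : Fin n} → b ∈ B → Positive L B (pos b x)
  and    : ∀ {n} {φ ψ : Fm k n} → Positive L B φ → Positive L B ψ → Positive L B (φ ∧' ψ)
  or     : ∀ {n} {φ ψ : Fm k n} → Positive L B φ → Positive L B ψ → Positive L B (φ ∨' ψ)
  exP    : ∀ {n} {φ : Fm k (suc n)} → Positive L B φ → Positive L B (ex φ)
  allP   : ∀ {n} {φ : Fm k (suc n)} → Positive L B φ → Positive L B (all φ)
  exinfP : ∀ {n} {φ : Fm k (suc n)} → IsTrue (allowsInf L) → Positive L B φ → Positive L B (exinf φ)
  allinfP : ∀ {n} {φ : Fm k (suc n)} → IsTrue (allowsInf L) → Positive L B φ → Positive L B (allinf φ)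

-- Semantics.  A model is a set D with a valuation V : A → ℘(D),
-- subsets represented as predicates D → Set.  D may be empty.
Valuation : ℕ → Set → Set₁
Valuation k D = Fin k → D → Set

Finite : {D : Set} → (D → Set) → Set
Finite {D} P = Σ (List D) λ l → ∀ d → P d → d ∈L l

extend : ∀ {D : Set} {n} → D → (Fin n → D) → Fin (suc n) → D
extend d g zero = d
extend d g (suc i) = g i

⟦_⟧ : ∀ {k n} → Fm k n → (D : Set) → Valuation k D → (Fin n → D) → Set
⟦ tt ⟧ D V g = ⊤
⟦ ff ⟧ D V g = ⊥
⟦ pos a x ⟧ D V g = V a (g x)
⟦ neg a x ⟧ D V g = ¬ V a (g x)
⟦ eq x y ⟧ D V g = g x ≡ g y
⟦ neq x y ⟧ D V g = g x ≢ g y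
⟦ φ ∨' ψ ⟧ D V g = ⟦ φ ⟧ D V g ⊎ ⟦ ψ ⟧ D V g
⟦ φ ∧' ψ ⟧ D V g = ⟦ φ ⟧ D V g × ⟦ ψ ⟧ D V g
⟦ ex φ ⟧ D V g = Σ D λ d → ⟦ φ ⟧ D V (extend d g)
⟦ all φ ⟧ D V g = ∀ d → ⟦ φ ⟧ D V (extend d g)
⟦ exinf φ ⟧ D V g = ¬ Finite (λ d → ⟦ φ ⟧ D V (extend d g))
⟦ allinf φ ⟧ D V g = Finite (λ d → ¬ ⟦ φ ⟧ D V (extend d g))

noVars : {D : Set} → Fin 0 → D
noVars ()

_≤[_]_ : ∀ {k} {D : Set} → Valuation k D → Subset k → Valuation k D → Set
V ≤[ B ] V' = (∀ b → b ∈ B → ∀ d → V b d → V' b d)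
            × (∀ a → a ∉ B → ∀ d → (V a d → V' a d) × (V' a d → V a d))

Monotone : ∀ {k n} → Subset k → Fm k n → Set₁
Monotone {k} {n} B φ = (D : Set) (V V' : Valuation k D) (g : Fin n → D) →
  V ≤[ B ] V' → ⟦ φ ⟧ D V g → ⟦ φ ⟧ D V' g

Equivalent : ∀ {k} → Sentence k → Sentence k → Set₁
Equivalent {k} φ ψ = (D : Set) (V : Valuation k D) →
  (⟦ φ ⟧ D V noVars → ⟦ ψ ⟧ D V noVars) × (⟦ ψ ⟧ D V noVars → ⟦ φ ⟧ D V noVars)

{-# OPTIONS --safe #-}
-- Up to a given quantifier rank, a model is determined by its state: the number of
-- elements of each type (set of predicates true of an element), cut off at the rank,
-- or infinite.  Truth in a state is decidable, since a new element can be drawn from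
-- any type that is not exhausted.  Replace each state satisfying φ by a formula saying
-- that the state can be obtained by shrinking the predicates in B, and let φ⁺ be the
-- (B-positive) disjunction.  Then φ entails φ⁺.  Conversely, a model of φ⁺ lies
-- above, in the order ≤[ B ], a model of φ on the same domain, so φ⁺ entails φ if φ is
-- monotone.  Hence φ is monotone iff φ⁺ entails φ, which is checked on the finitely many
-- states.  For M, equality and ∃^∞ are eliminated from φ⁺ by evaluating it in D × ℕ.
module Submission where

open import Defs
open import Level using (0ℓ)
open import Axiom.ExcludedMiddle using (ExcludedMiddle)
open import Data.Nat using (ℕ; zero; suc; pred; _+_; _*_; _≤_; _<_; z≤n; s≤s; s≤s⁻¹; NonZero)
open import Data.Nat.Properties using (≤-refl; ≤-trans; ≤-reflexive; m≤m+n; m≤n+m; m≤n⇒m≤1+n; <-cmp; +-cancelˡ-≡; *-cancelʳ-≡; +-identityʳ; m≤n⇒m<n∨m≡n)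
open import Data.Nat.DivMod using (_mod_; m%n<n; m<n⇒m%n≡m; [m+kn]%n≡m%n)
open import Data.Bool using (Bool; true; false; if_then_else_)
import Data.Bool.Properties as Bool
open import Data.Fin using (Fin; zero; suc; toℕ)
import Data.Fin as Fin
import Data.Fin.Properties as Fin
open import Data.Fin.Subset using (Subset; _∉_; ⊥)
open import Data.Fin.Subset.Properties using (_∈?_; ∉⊥; anySubset?)
open import Data.List using (List; []; _∷_; _++_; length; map; concatMap; tabulate; allFin; applyUpTo; replicate; lookup; cartesianProductWith)
open import Data.List.Properties using (length-tabulate; length-removeAt′)
open import Data.List.Membership.Propositional using (lose; find) renaming (_∈_ to _∈L_; _∉_ to _∉L_)
open import Data.List.Membership.Propositional.Properties using (∈-++⁺ˡ; ∈-++⁺ʳ; ∈-tabulate⁺; ∈-allFin; ∈-concatMap⁺; ∈-map⁺)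
open import Data.List.Relation.Unary.Any as Any using (Any; here; there; satisfied; index; _─_)
import Data.List.Relation.Unary.Any.Properties as Any
open import Data.List.Relation.Unary.All as All using (All; []; _∷_; all?)
import Data.List.Relation.Unary.All.Properties as All
open import Data.Product using (Σ; _×_; _,_; proj₁; proj₂; map₂)
open import Data.Product.Function.NonDependent.Propositional using (_×-⇔_)
open import Data.Sum using (_⊎_; inj₁; inj₂; [_,_]′)
open import Data.Sum.Function.Propositional using (_⊎-⇔_)
open import Data.Unit using (⊤)
import Data.Empty as Empty
open import Data.Vec as Vec using ([]; _∷_)
import Data.Vec.Properties as Vec
open import Function using (_∘_; id; const; case_of_)
open import Function.Bundles using (_⇔_; mk⇔; Equivalence)
open import Function.Properties.Equivalence using () renaming (refl to ⇔-refl; sym to ⇔-sym; trans to ⇔-trans)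
open import Function.Related.TypeIsomorphisms using (¬-cong-⇔)
open import Relation.Binary.Definitions using (tri<; tri≈; tri>)
open import Relation.Binary.PropositionalEquality using (_≡_; _≢_; refl; sym; trans; cong; cong₂; subst; setoid)
open import Relation.Nullary using (¬_; Dec; yes; no; does; ¬?; contradiction; _×-dec_; _⊎-dec_; _→-dec_)
open import Relation.Nullary.Decidable using (decidable-stable; dec-true)
import Relation.Nullary.Decidable as Dec

open Equivalence using (to; from)

-- Ordinary quantifiers also range over elements that are already named, which would tie a state to
-- the assignment. If every quantifier avoids the named elements, equality disappears: two variables
-- are equal just if they carry the same name, and choosing an element only lowers the count of its
-- type by one. The obstacle in shrinking a model lies in the infinite types. An element may lie
-- above several of them, yet it can be given only one type, and each infinite type must still
-- receive infinitely many elements. Pairwise disjoint infinite parts are therefore carved out of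
-- the overlapping sets before the other elements are assigned. Monotonicity is a property of the
-- models of a sentence and not of its language, so the test always works in ME^∞. The formula φ⁺
-- and the test are built without excluded middle, which enters only their correctness; hence the
-- decision function can be given outside that hypothesis. The test compares the two sentences φ⁺
-- and φ, so its states are cut off at the sum of the two ranks, a bound for both.

private variable
  k n p m : ℕ
  A D : Set

-- Congruences for logical equivalence and finiteness

Π-⇔ : {P Q : A → Set} → (∀ x → P x ⇔ Q x) → (∀ x → P x) ⇔ (∀ x → Q x)
Π-⇔ e = mk⇔ (λ f x → to (e x) (f x)) (λ f x → from (e x) (f x))

Σ-⇔ : {P Q : A → Set} → (∀ x → P x ⇔ Q x) → Σ A P ⇔ Σ A Q
Σ-⇔ e = mk⇔ (λ (x , y) → x , to (e x) y) (λ (x , y) → x , from (e x) y)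

→-⇔ : {B C : Set} → (A → B ⇔ C) → (A → B) ⇔ (A → C)
→-⇔ e = mk⇔ (λ f x → to (e x) (f x)) (λ f x → from (e x) (f x))

×ʳ-⇔ : {B C : Set} → (A → B ⇔ C) → (A × B) ⇔ (A × C)
×ʳ-⇔ e = mk⇔ (λ (x , y) → x , to (e x) y) (λ (x , y) → x , from (e x) y)

Finite-⊆ : {P Q : D → Set} → (∀ d → P d → Q d) → Finite Q → Finite P
Finite-⊆ s (l , c) = l , λ d → c d ∘ s d

Finite-⇔ : {P Q : D → Set} → (∀ d → P d ⇔ Q d) → Finite P ⇔ Finite Q
Finite-⇔ e = mk⇔ (Finite-⊆ (λ d → from (e d))) (Finite-⊆ (λ d → to (e d)))

-- Formulas with exclusive quantifiers

-- Equality-free formulas, evaluated at injective assignments: each quantifier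
-- ranges over the elements not yet named by a variable.
infixr 6 _∧ₓ_
infixr 5 _∨ₓ_

data XF (k p : ℕ) : Set where
  ttₓ ffₓ        : XF k p
  posₓ negₓ      : Fin k → Fin p → XF k p
  _∨ₓ_ _∧ₓ_      : XF k p → XF k p → XF k p
  exₓ allₓ       : XF k (suc p) → XF k p
  exinfₓ allinfₓ : XF k (suc p) → XF k p

Fresh : (Fin p → D) → D → Set
Fresh h d = ∀ i → h i ≢ d

⟦_⟧ₓ : XF k p → (D : Set) → Valuation k D → (Fin p → D) → Set
⟦ ttₓ ⟧ₓ D V h = ⊤
⟦ ffₓ ⟧ₓ D V h = Empty.⊥
⟦ posₓ a x ⟧ₓ D V h = V a (h x)
⟦ negₓ a x ⟧ₓ D V h = ¬ V a (h x)
⟦ ξ ∨ₓ ζ ⟧ₓ D V h = ⟦ ξ ⟧ₓ D V h ⊎ ⟦ ζ ⟧ₓ D V h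
⟦ ξ ∧ₓ ζ ⟧ₓ D V h = ⟦ ξ ⟧ₓ D V h × ⟦ ζ ⟧ₓ D V h
⟦ exₓ ξ ⟧ₓ D V h = Σ D λ d → Fresh h d × ⟦ ξ ⟧ₓ D V (extend d h)
⟦ allₓ ξ ⟧ₓ D V h = ∀ d → Fresh h d → ⟦ ξ ⟧ₓ D V (extend d h)
⟦ exinfₓ ξ ⟧ₓ D V h = ¬ Finite λ d → Fresh h d × ⟦ ξ ⟧ₓ D V (extend d h)
⟦ allinfₓ ξ ⟧ₓ D V h = Finite λ d → Fresh h d × ¬ ⟦ ξ ⟧ₓ D V (extend d h)

Posₓ : Logic → Subset k → XF k p → Set
Posₓ L B ttₓ = ⊤
Posₓ L B ffₓ = ⊤
Posₓ L B (posₓ a x) = ⊤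
Posₓ L B (negₓ a x) = a ∉ B
Posₓ L B (ξ ∨ₓ ζ) = Posₓ L B ξ × Posₓ L B ζ
Posₓ L B (ξ ∧ₓ ζ) = Posₓ L B ξ × Posₓ L B ζ
Posₓ L B (exₓ ξ) = Posₓ L B ξ
Posₓ L B (allₓ ξ) = Posₓ L B ξ
Posₓ L B (exinfₓ ξ) = IsTrue (allowsInf L) × Posₓ L B ξ
Posₓ L B (allinfₓ ξ) = IsTrue (allowsInf L) × Posₓ L B ξ

-- The sum at a connective bounds the quantifier depth of both parts.
rank : XF k p → ℕ
rank ttₓ = 0
rank ffₓ = 0
rank (posₓ a x) = 0
rank (negₓ a x) = 0
rank (ξ ∨ₓ ζ) = rank ξ + rank ζ
rank (ξ ∧ₓ ζ) = rank ξ + rank ζ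
rank (exₓ ξ) = suc (rank ξ)
rank (allₓ ξ) = suc (rank ξ)
rank (exinfₓ ξ) = suc (rank ξ)
rank (allinfₓ ξ) = suc (rank ξ)

⋁ ⋀ : (A → XF k p) → List A → XF k p
⋁ f [] = ffₓ
⋁ f (a ∷ l) = f a ∨ₓ ⋁ f l
⋀ f [] = ttₓ
⋀ f (a ∷ l) = f a ∧ₓ ⋀ f l

module _ {V : Valuation k D} {h : Fin p → D} (f : A → XF k p) where

  ⋁-Any : ∀ l → ⟦ ⋁ f l ⟧ₓ D V h ⇔ Any (λ a → ⟦ f a ⟧ₓ D V h) l
  ⋁-Any [] = mk⇔ (λ ()) (λ ())
  ⋁-Any (a ∷ l) = mk⇔ [ here , there ∘ to (⋁-Any l) ]′
    λ { (here x) → inj₁ x ; (there x) → inj₂ (from (⋁-Any l) x) }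

  ⋀-All : ∀ l → ⟦ ⋀ f l ⟧ₓ D V h ⇔ All (λ a → ⟦ f a ⟧ₓ D V h) l
  ⋀-All [] = mk⇔ (λ _ → []) _
  ⋀-All (a ∷ l) = mk⇔ (λ (x , y) → x ∷ to (⋀-All l) y) λ { (x ∷ y) → x , from (⋀-All l) y }

  ⋁-Σ : ∀ {l} → (∀ a → a ∈L l) → ⟦ ⋁ f l ⟧ₓ D V h ⇔ Σ A λ a → ⟦ f a ⟧ₓ D V h
  ⋁-Σ all∈l = ⇔-trans (⋁-Any _) (mk⇔ satisfied λ (a , x) → lose (all∈l a) x)

  ⋀-Π : ∀ {l} → (∀ a → a ∈L l) → ⟦ ⋀ f l ⟧ₓ D V h ⇔ (∀ a → ⟦ f a ⟧ₓ D V h)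
  ⋀-Π all∈l = ⇔-trans (⋀-All _) (mk⇔ (λ xs a → All.lookup xs (all∈l a)) λ f → All.tabulate λ {a} _ → f a)

⋁-Posₓ : ∀ L B (f : A → XF k p) → (∀ a → Posₓ L B (f a)) → ∀ l → Posₓ L B (⋁ f l)
⋁-Posₓ L B f q [] = _
⋁-Posₓ L B f q (a ∷ l) = q a , ⋁-Posₓ L B f q l

⋀-Posₓ : ∀ L B (f : A → XF k p) → (∀ a → Posₓ L B (f a)) → ∀ l → Posₓ L B (⋀ f l)
⋀-Posₓ L B f q [] = _
⋀-Posₓ L B f q (a ∷ l) = q a , ⋀-Posₓ L B f q l

-- The side condition is decided while the formula is built, so the formula itself mentions neither
-- equality nor types.
_&ₓ_ _⇒ₓ_ : {Q : Set} → Dec Q → XF k p → XF k p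
yes _ &ₓ ξ = ξ
no _ &ₓ ξ = ffₓ
yes _ ⇒ₓ ξ = ξ
no _ ⇒ₓ ξ = ttₓ

module _ {V : Valuation k D} {h : Fin p → D} {Q : Set} where

  &ₓ-⇔ : (q : Dec Q) (ξ : XF k p) → ⟦ q &ₓ ξ ⟧ₓ D V h ⇔ (Q × ⟦ ξ ⟧ₓ D V h)
  &ₓ-⇔ (yes q) ξ = mk⇔ (q ,_) proj₂
  &ₓ-⇔ (no ¬q) ξ = mk⇔ (λ ()) (¬q ∘ proj₁)

  ⇒ₓ-⇔ : (q : Dec Q) (ξ : XF k p) → ⟦ q ⇒ₓ ξ ⟧ₓ D V h ⇔ (Q → ⟦ ξ ⟧ₓ D V h)
  ⇒ₓ-⇔ (yes q) ξ = mk⇔ const (λ f → f q)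
  ⇒ₓ-⇔ (no ¬q) ξ = mk⇔ (λ _ q → contradiction q ¬q) _

&ₓ-Posₓ : ∀ {L B} {Q : Set} (q : Dec Q) (ξ : XF k p) → Posₓ L B ξ → Posₓ L B (q &ₓ ξ)
&ₓ-Posₓ (yes _) ξ x = x
&ₓ-Posₓ (no _) ξ x = _

⇒ₓ-Posₓ : ∀ {L B} {Q : Set} (q : Dec Q) (ξ : XF k p) → (Q → Posₓ L B ξ) → Posₓ L B (q ⇒ₓ ξ)
⇒ₓ-Posₓ (yes q) ξ x = x q
⇒ₓ-Posₓ (no _) ξ x = _

Inj : (Fin p → D) → Set
Inj h = ∀ i j → h i ≡ h j → i ≡ j

extend-Inj : {d : D} {h : Fin p → D} → Fresh h d → Inj h → Inj (extend d h)
extend-Inj fr inj zero zero e = refl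
extend-Inj fr inj zero (suc j) e = contradiction (sym e) (fr j)
extend-Inj fr inj (suc i) zero e = contradiction e (fr i)
extend-Inj fr inj (suc i) (suc j) e = cong suc (inj i j e)

-- Translating formulas into exclusive ones

-- ρ sends each variable to the exclusive variable naming its value.
tr : Fm k n → (Fin n → Fin p) → XF k p
tr tt ρ = ttₓ
tr ff ρ = ffₓ
tr (pos a x) ρ = posₓ a (ρ x)
tr (neg a x) ρ = negₓ a (ρ x)
tr (eq x y) ρ = (ρ x Fin.≟ ρ y) &ₓ ttₓ
tr (neq x y) ρ = (ρ x Fin.≟ ρ y) ⇒ₓ ffₓ
tr (φ ∨' ψ) ρ = tr φ ρ ∨ₓ tr ψ ρ
tr (φ ∧' ψ) ρ = tr φ ρ ∧ₓ tr ψ ρ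
tr (ex φ) ρ = ⋁ (λ i → tr φ (extend i ρ)) (allFin _) ∨ₓ exₓ (tr φ (extend zero (suc ∘ ρ)))
tr (all φ) ρ = ⋀ (λ i → tr φ (extend i ρ)) (allFin _) ∧ₓ allₓ (tr φ (extend zero (suc ∘ ρ)))
tr (exinf φ) ρ = exinfₓ (tr φ (extend zero (suc ∘ ρ)))
tr (allinf φ) ρ = allinfₓ (tr φ (extend zero (suc ∘ ρ)))

-- With the empty set `⊥` in place of `B`, the condition on negated atoms is void. What remains is
-- that infinity quantifiers occur only where `L` allows them, as `Ev-⇔` requires.
tr-Posₓ : ∀ {L} (φ : Fm k n) (ρ : Fin n → Fin p) → In L φ → Posₓ L ⊥ (tr φ ρ)
tr-Posₓ tt ρ _ = _
tr-Posₓ ff ρ _ = _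
tr-Posₓ (pos a x) ρ _ = _
tr-Posₓ (neg a x) ρ _ = ∉⊥
tr-Posₓ (eq x y) ρ _ = &ₓ-Posₓ (ρ x Fin.≟ ρ y) ttₓ _
tr-Posₓ (neq x y) ρ _ = ⇒ₓ-Posₓ (ρ x Fin.≟ ρ y) ffₓ _
tr-Posₓ (φ ∨' ψ) ρ (i , j) = tr-Posₓ φ ρ i , tr-Posₓ ψ ρ j
tr-Posₓ (φ ∧' ψ) ρ (i , j) = tr-Posₓ φ ρ i , tr-Posₓ ψ ρ j
tr-Posₓ (ex φ) ρ i = ⋁-Posₓ _ _ (λ j → tr φ (extend j ρ)) (λ _ → tr-Posₓ φ _ i) (allFin _) , tr-Posₓ φ _ i
tr-Posₓ (all φ) ρ i = ⋀-Posₓ _ _ (λ j → tr φ (extend j ρ)) (λ _ → tr-Posₓ φ _ i) (allFin _) , tr-Posₓ φ _ i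
tr-Posₓ (exinf φ) ρ (b , i) = b , tr-Posₓ φ _ i
tr-Posₓ (allinf φ) ρ (b , i) = b , tr-Posₓ φ _ i

named : (h : Fin p → D) (ρ : Fin n → Fin p) {g : Fin n → D} → (∀ x → g x ≡ h (ρ x)) →
  ∀ i x → extend (h i) g x ≡ h (extend i ρ x)
named h ρ e i zero = refl
named h ρ e i (suc x) = e x

fresh : (h : Fin p → D) (ρ : Fin n → Fin p) {g : Fin n → D} → (∀ x → g x ≡ h (ρ x)) →
  ∀ d x → extend d g x ≡ extend d h (extend zero (suc ∘ ρ) x)
fresh h ρ e d zero = refl
fresh h ρ e d (suc x) = e x

-- Translating exclusive formulas back

oneOf noneOf : (Fin m → Fin n) → Fm k (suc n)
oneOf {zero} f = ff
oneOf {suc m} f = eq (suc (f zero)) zero ∨' oneOf (f ∘ suc)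
noneOf {zero} f = tt
noneOf {suc m} f = neq (suc (f zero)) zero ∧' noneOf (f ∘ suc)

module _ {V : Valuation k D} {g : Fin n → D} {d : D} where

  oneOf-⇔ : (f : Fin m → Fin n) → ⟦ oneOf f ⟧ D V (extend d g) ⇔ Σ (Fin m) λ i → g (f i) ≡ d
  oneOf-⇔ {zero} f = mk⇔ (λ ()) (λ ())
  oneOf-⇔ {suc m} f = mk⇔
    [ zero ,_ , (λ x → let i , e = to (oneOf-⇔ (f ∘ suc)) x in suc i , e) ]′
    λ { (zero , e) → inj₁ e ; (suc i , e) → inj₂ (from (oneOf-⇔ (f ∘ suc)) (i , e)) }

  noneOf-⇔ : (f : Fin m → Fin n) → ⟦ noneOf f ⟧ D V (extend d g) ⇔ Fresh (g ∘ f) d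
  noneOf-⇔ {zero} f = mk⇔ (λ _ ()) _
  noneOf-⇔ {suc m} f = mk⇔
    (λ { (x , y) zero → x ; (x , y) (suc i) → to (noneOf-⇔ (f ∘ suc)) y i })
    (λ x → x zero , from (noneOf-⇔ (f ∘ suc)) (x ∘ suc))

module _ {L : Logic} {B : Subset k} (equality : IsTrue (allowsEq L)) where

  oneOf-Positive : (f : Fin m → Fin n) → Positive L B (oneOf f)
  oneOf-Positive {zero} f = base _ _
  oneOf-Positive {suc m} f = or (base equality _) (oneOf-Positive (f ∘ suc))

  noneOf-Positive : (f : Fin m → Fin n) → Positive L B (noneOf f)
  noneOf-Positive {zero} f = base _ _
  noneOf-Positive {suc m} f = and (base equality _) (noneOf-Positive (f ∘ suc))

pos-Positive : ∀ L (B : Subset k) a (x : Fin n) → Positive L B (pos a x)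
pos-Positive L B a x with a ∈? B
... | yes a∈B = atom a∈B
... | no a∉B = base _ a∉B

back : XF k p → Fm k p
back ttₓ = tt
back ffₓ = ff
back (posₓ a x) = pos a x
back (negₓ a x) = neg a x
back (ξ ∨ₓ ζ) = back ξ ∨' back ζ
back (ξ ∧ₓ ζ) = back ξ ∧' back ζ
back (exₓ ξ) = ex (noneOf id ∧' back ξ)
back (allₓ ξ) = all (oneOf id ∨' back ξ)
back (exinfₓ ξ) = exinf (noneOf id ∧' back ξ)
back (allinfₓ ξ) = allinf (oneOf id ∨' back ξ)

back-Positive : ∀ {L} {B : Subset k} → IsTrue (allowsEq L) → (ξ : XF k p) → Posₓ L B ξ → Positive L B (back ξ)
back-Positive e ttₓ q = base _ _
back-Positive e ffₓ q = base _ _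
back-Positive e (posₓ a x) q = pos-Positive _ _ a x
back-Positive e (negₓ a x) q = base _ q
back-Positive e (ξ ∨ₓ ζ) (q , r) = or (back-Positive e ξ q) (back-Positive e ζ r)
back-Positive e (ξ ∧ₓ ζ) (q , r) = and (back-Positive e ξ q) (back-Positive e ζ r)
back-Positive e (exₓ ξ) q = exP (and (noneOf-Positive e id) (back-Positive e ξ q))
back-Positive e (allₓ ξ) q = allP (or (oneOf-Positive e id) (back-Positive e ξ q))
back-Positive e (exinfₓ ξ) (i , q) = exinfP i (and (noneOf-Positive e id) (back-Positive e ξ q))
back-Positive e (allinfₓ ξ) (i , q) = allinfP i (or (oneOf-Positive e id) (back-Positive e ξ q))

flat : XF k p → Fm k p
flat ttₓ = tt
flat ffₓ = ff
flat (posₓ a x) = pos a x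
flat (negₓ a x) = neg a x
flat (ξ ∨ₓ ζ) = flat ξ ∨' flat ζ
flat (ξ ∧ₓ ζ) = flat ξ ∧' flat ζ
flat (exₓ ξ) = ex (flat ξ)
flat (allₓ ξ) = all (flat ξ)
flat (exinfₓ ξ) = ex (flat ξ)
flat (allinfₓ ξ) = all (flat ξ)

flat-Positive : ∀ {L} {B : Subset k} (ξ : XF k p) → Posₓ L B ξ → Positive M B (flat ξ)
flat-Positive ttₓ q = base _ _
flat-Positive ffₓ q = base _ _
flat-Positive (posₓ a x) q = pos-Positive _ _ a x
flat-Positive (negₓ a x) q = base _ q
flat-Positive (ξ ∨ₓ ζ) (q , r) = or (flat-Positive ξ q) (flat-Positive ζ r)
flat-Positive (ξ ∧ₓ ζ) (q , r) = and (flat-Positive ξ q) (flat-Positive ζ r)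
flat-Positive (exₓ ξ) q = exP (flat-Positive ξ q)
flat-Positive (allₓ ξ) q = allP (flat-Positive ξ q)
flat-Positive (exinfₓ ξ) (i , q) = exP (flat-Positive ξ q)
flat-Positive (allinfₓ ξ) (i , q) = allP (flat-Positive ξ q)

-- The blow-up D × ℕ of a model has the same M-theory and infinitely many copies
-- of each element, so there exclusive quantifiers are plain ones and ∃^∞ is ∃.
blowup : Valuation k D → Valuation k (D × ℕ)
blowup V a (d , _) = V a d

blowup-⇔ : (φ : Fm k n) {V : Valuation k D} {g : Fin n → D} {h : Fin n → D × ℕ} → In M φ →
  (∀ x → proj₁ (h x) ≡ g x) → ⟦ φ ⟧ (D × ℕ) (blowup V) h ⇔ ⟦ φ ⟧ D V g
blowup-⇔ tt i e = ⇔-refl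
blowup-⇔ ff i e = ⇔-refl
blowup-⇔ (pos a x) i e rewrite e x = ⇔-refl
blowup-⇔ (neg a x) i e rewrite e x = ⇔-refl
blowup-⇔ (φ ∨' ψ) (i , j) e = blowup-⇔ φ i e ⊎-⇔ blowup-⇔ ψ j e
blowup-⇔ (φ ∧' ψ) (i , j) e = blowup-⇔ φ i e ×-⇔ blowup-⇔ ψ j e
blowup-⇔ (ex φ) i e = mk⇔
  (λ ((d , m) , x) → d , to (blowup-⇔ φ i λ { zero → refl ; (suc y) → e y }) x)
  (λ (d , x) → (d , 0) , from (blowup-⇔ φ i λ { zero → refl ; (suc y) → e y }) x)
blowup-⇔ (all φ) i e = mk⇔
  (λ x d → to (blowup-⇔ φ i λ { zero → refl ; (suc y) → e y }) (x (d , 0)))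
  (λ x (d , m) → from (blowup-⇔ φ i λ { zero → refl ; (suc y) → e y }) (x d))

-- Positive formulas are monotone

avoids-⇔ : ∀ {B : Subset k} {V V' : Valuation k D} → V ≤[ B ] V' → (φ : Fm k n) → AvoidsB B φ →
  (g : Fin n → D) → ⟦ φ ⟧ D V g ⇔ ⟦ φ ⟧ D V' g
avoids-⇔ le tt av g = ⇔-refl
avoids-⇔ le ff av g = ⇔-refl
avoids-⇔ le (pos a x) av g = let f , f' = proj₂ le a av (g x) in mk⇔ f f'
avoids-⇔ le (neg a x) av g = let f , f' = proj₂ le a av (g x) in ¬-cong-⇔ (mk⇔ f f')
avoids-⇔ le (eq x y) av g = ⇔-refl
avoids-⇔ le (neq x y) av g = ⇔-refl
avoids-⇔ le (φ ∨' ψ) (av , aw) g = avoids-⇔ le φ av g ⊎-⇔ avoids-⇔ le ψ aw g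
avoids-⇔ le (φ ∧' ψ) (av , aw) g = avoids-⇔ le φ av g ×-⇔ avoids-⇔ le ψ aw g
avoids-⇔ le (ex φ) av g = Σ-⇔ λ d → avoids-⇔ le φ av (extend d g)
avoids-⇔ le (all φ) av g = Π-⇔ λ d → avoids-⇔ le φ av (extend d g)
avoids-⇔ le (exinf φ) av g = ¬-cong-⇔ (Finite-⇔ λ d → avoids-⇔ le φ av (extend d g))
avoids-⇔ le (allinf φ) av g = Finite-⇔ λ d → ¬-cong-⇔ (avoids-⇔ le φ av (extend d g))

positive-monotone : ∀ {L} {B : Subset k} {φ : Fm k n} → Positive L B φ → Monotone B φ
positive-monotone (base {ψ = ψ} i av) D V V' g le = to (avoids-⇔ le ψ av g)
positive-monotone (atom b∈B) D V V' g le = proj₁ le _ b∈B _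
positive-monotone (and q r) D V V' g le (x , y) = positive-monotone q D V V' g le x , positive-monotone r D V V' g le y
positive-monotone (or q r) D V V' g le =
  [ inj₁ ∘ positive-monotone q D V V' g le , inj₂ ∘ positive-monotone r D V V' g le ]′
positive-monotone (exP q) D V V' g le (d , x) = d , positive-monotone q D V V' _ le x
positive-monotone (allP q) D V V' g le x d = positive-monotone q D V V' _ le (x d)
positive-monotone (exinfP i q) D V V' g le = _∘ Finite-⊆ λ d → positive-monotone q D V V' _ le
positive-monotone (allinfP i q) D V V' g le = Finite-⊆ λ d → _∘ positive-monotone q D V V' _ le

-- `Monotone` speaks of every assignment `Fin 0 → D` and `Equivalent` of `noVars` alone; without
-- function extensionality the two agree only pointwise.
⟦⟧-cong : (φ : Fm k n) {V : Valuation k D} {g g' : Fin n → D} → (∀ x → g x ≡ g' x) → ⟦ φ ⟧ D V g ⇔ ⟦ φ ⟧ D V g'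
⟦⟧-cong tt e = ⇔-refl
⟦⟧-cong ff e = ⇔-refl
⟦⟧-cong (pos a x) e rewrite e x = ⇔-refl
⟦⟧-cong (neg a x) e rewrite e x = ⇔-refl
⟦⟧-cong (eq x y) e rewrite e x | e y = ⇔-refl
⟦⟧-cong (neq x y) e rewrite e x | e y = ⇔-refl
⟦⟧-cong (φ ∨' ψ) e = ⟦⟧-cong φ e ⊎-⇔ ⟦⟧-cong ψ e
⟦⟧-cong (φ ∧' ψ) e = ⟦⟧-cong φ e ×-⇔ ⟦⟧-cong ψ e
⟦⟧-cong (ex φ) e = Σ-⇔ λ d → ⟦⟧-cong φ λ { zero → refl ; (suc x) → e x }
⟦⟧-cong (all φ) e = Π-⇔ λ d → ⟦⟧-cong φ λ { zero → refl ; (suc x) → e x }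
⟦⟧-cong (exinf φ) e = ¬-cong-⇔ (Finite-⇔ λ d → ⟦⟧-cong φ λ { zero → refl ; (suc x) → e x })
⟦⟧-cong (allinf φ) e = Finite-⇔ λ d → ¬-cong-⇔ (⟦⟧-cong φ λ { zero → refl ; (suc x) → e x })

monotone-sentence : {B : Subset k} (φ ψ : Sentence k) → Equivalent φ ψ → Monotone B ψ → Monotone B φ
monotone-sentence φ ψ e mono D V V' g le x =
  to (⟦⟧-cong φ λ ()) (proj₂ (e D V') (mono D V V' noVars le (proj₁ (e D V) (to (⟦⟧-cong φ λ ()) x))))

-- States: how many elements realise each type

-- A type lists the predicates true of an element.
Ty : ℕ → Set
Ty = Subset

infix 4 _≟_
_≟_ : (s t : Ty k) → Dec (s ≡ t)
_≟_ = Vec.≡-dec Bool._≟_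

types : ∀ k → List (Ty k)
types zero = [] ∷ []
types (suc k) = map (true ∷_) (types k) ++ map (false ∷_) (types k)

∈-types : (t : Ty k) → t ∈L types k
∈-types [] = here refl
∈-types (true ∷ t) = ∈-++⁺ˡ (∈-map⁺ (true ∷_) (∈-types t))
∈-types (false ∷ t) = ∈-++⁺ʳ _ (∈-map⁺ (false ∷_) (∈-types t))

-- many m: finitely many, but at least m (see HasCount).
data Cnt : Set where
  exact many : ℕ → Cnt
  inf        : Cnt

-- How many elements of the class a description names explicitly. After that an `exact` class is
-- exhausted, a `many` class has met its minimum, and the infinity of `inf` is left to `restInf`.
size : Cnt → ℕ
size (exact m) = m
size (many m) = m
size inf = 0

dec : Cnt → Cnt
dec (exact m) = exact (pred m)
dec (many m) = many (pred m)
dec inf = inf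

-- An `Open` class may still hold elements after `size` many have been drawn. `many 0` counts as
-- `Present` because it may be inhabited.
IsInf Open Present : Cnt → Set
IsInf inf = ⊤
IsInf _ = Empty.⊥
Open (exact _) = Empty.⊥
Open _ = ⊤
Present (exact 0) = Empty.⊥
Present _ = ⊤

IsInf? : ∀ x → Dec (IsInf x)
IsInf? (exact _) = no λ ()
IsInf? (many _) = no λ ()
IsInf? inf = yes _

Open? : ∀ x → Dec (Open x)
Open? (exact _) = no λ ()
Open? (many _) = yes _
Open? inf = yes _

Present? : ∀ x → Dec (Present x)
Present? (exact zero) = no λ ()
Present? (exact (suc _)) = yes _
Present? (many _) = yes _
Present? inf = yes _

State : ℕ → Set
State k = Ty k → Cnt

use : Ty k → State k → State k
use t c s = if does (s ≟ t) then dec (c s) else c s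

-- The state records the elements that are not yet named; ts the types of the
-- named ones.
Ev : XF k p → State k → (Fin p → Ty k) → Set
Ev ttₓ c ts = ⊤
Ev ffₓ c ts = Empty.⊥
Ev (posₓ a x) c ts = Vec.lookup (ts x) a ≡ true
Ev (negₓ a x) c ts = ¬ Vec.lookup (ts x) a ≡ true
Ev (ξ ∨ₓ ζ) c ts = Ev ξ c ts ⊎ Ev ζ c ts
Ev (ξ ∧ₓ ζ) c ts = Ev ξ c ts × Ev ζ c ts
Ev (exₓ ξ) c ts = Σ (Ty _) λ t → Present (c t) × Ev ξ (use t c) (extend t ts)
Ev (allₓ ξ) c ts = ∀ t → Present (c t) → Ev ξ (use t c) (extend t ts)
Ev (exinfₓ ξ) c ts = Σ (Ty _) λ t → IsInf (c t) × Ev ξ (use t c) (extend t ts)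
Ev (allinfₓ ξ) c ts = ∀ t → IsInf (c t) → Ev ξ (use t c) (extend t ts)

allTypes? : {P : Ty k → Set} → (∀ t → Dec (P t)) → Dec (∀ t → P t)
allTypes? P? = Dec.map′ (λ none t → decidable-stable (P? t) λ ¬x → none (t , ¬x))
  (λ f (t , ¬x) → ¬x (f t)) (¬? (anySubset? (¬? ∘ P?)))

Ev? : (ξ : XF k p) (c : State k) (ts : Fin p → Ty k) → Dec (Ev ξ c ts)
Ev? ttₓ c ts = yes _
Ev? ffₓ c ts = no λ ()
Ev? (posₓ a x) c ts = Vec.lookup (ts x) a Bool.≟ true
Ev? (negₓ a x) c ts = ¬? (Vec.lookup (ts x) a Bool.≟ true)
Ev? (ξ ∨ₓ ζ) c ts = Ev? ξ c ts ⊎-dec Ev? ζ c ts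
Ev? (ξ ∧ₓ ζ) c ts = Ev? ξ c ts ×-dec Ev? ζ c ts
Ev? (exₓ ξ) c ts = anySubset? λ t → Present? (c t) ×-dec Ev? ξ (use t c) (extend t ts)
Ev? (allₓ ξ) c ts = allTypes? λ t → Present? (c t) →-dec Ev? ξ (use t c) (extend t ts)
Ev? (exinfₓ ξ) c ts = anySubset? λ t → IsInf? (c t) ×-dec Ev? ξ (use t c) (extend t ts)
Ev? (allinfₓ ξ) c ts = allTypes? λ t → IsInf? (c t) →-dec Ev? ξ (use t c) (extend t ts)

-- A formula of rank q cannot tell apart two sizes ≥ q.
Adequate : ℕ → Cnt → Set
Adequate q (many m) = q ≤ m
Adequate q _ = ⊤

Adequate-≤ : ∀ {q r} x → q ≤ r → Adequate r x → Adequate q x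
Adequate-≤ (exact _) le a = _
Adequate-≤ (many _) le a = ≤-trans le a
Adequate-≤ inf le a = _

Adequate-use : ∀ {q} t (c : State k) → (∀ s → Adequate (suc q) (c s)) → ∀ s → Adequate q (use t c s)
Adequate-use t c a s with s ≟ t | c s | a s
... | yes _ | exact _ | _ = _
... | yes _ | many (suc m) | s≤s le = le
... | yes _ | inf | _ = _
... | no _ | exact _ | _ = _
... | no _ | many m | le = ≤-trans (m≤n⇒m≤1+n ≤-refl) le
... | no _ | inf | _ = _

-- Escaping every short list replaces a choice of `m` distinct elements; adding or removing an
-- element then amounts to deleting it from a list or consing it on.
AtLeast : ℕ → (D → Set) → Set
AtLeast {D} m P = (l : List D) → length l < m → Σ D λ d → P d × d ∉L l

-- Without the infinity quantifiers, many m does not exclude an infinite set.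
HasCount : Logic → (D → Set) → Cnt → Set
HasCount {D} L P (exact m) = AtLeast m P × Σ (List D) λ l → length l ≤ m × (∀ d → P d → d ∈L l)
HasCount L P (many m) = AtLeast m P × (IsTrue (allowsInf L) → Finite P)
HasCount L P inf = ¬ Finite P

HasCount-⇔ : ∀ {L} {P Q : D → Set} → (∀ d → P d ⇔ Q d) → ∀ x → HasCount L P x → HasCount L Q x
HasCount-⇔ e (exact m) (al , l , le , c) =
  (λ l lt → let d , x , d∉l = al l lt in d , to (e d) x , d∉l) , l , le , λ d x → c d (from (e d) x)
HasCount-⇔ e (many m) (al , fin) =
  (λ l lt → let d , x , d∉l = al l lt in d , to (e d) x , d∉l) , λ i → to (Finite-⇔ e) (fin i)
HasCount-⇔ e inf nf = nf ∘ from (Finite-⇔ e)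

HasCount-Present : ∀ {L} {P : D → Set} {d} x → HasCount L P x → P d → Present x
HasCount-Present (exact zero) (_ , [] , _ , c) x with () ← c _ x
HasCount-Present (exact (suc _)) _ x = _
HasCount-Present (many _) _ x = _
HasCount-Present inf _ x = _

∈-─ : ∀ {x y : D} {l} (i : x ∈L l) → y ∈L l → x ≢ y → y ∈L (l ─ i)
∈-─ (here refl) (here refl) x≢y = contradiction refl x≢y
∈-─ (here refl) (there j) x≢y = j
∈-─ (there i) (here refl) x≢y = here refl
∈-─ (there i) (there j) x≢y = there (∈-─ i j x≢y)

Class : (Fin p → D) → (D → Ty k) → Ty k → D → Set
Class h τ t d = Fresh h d × τ d ≡ t

Counts : Logic → (Fin p → D) → (D → Ty k) → State k → Set
Counts L h τ c = ∀ t → HasCount L (Class h τ t) (c t)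

_Types_ : (D → Ty k) → Valuation k D → Set
τ Types V = ∀ a d → V a d ⇔ Vec.lookup (τ d) a ≡ true

Fresh-extend : {h : Fin p → D} {d e : D} → Fresh (extend d h) e ⇔ (Fresh h e × d ≢ e)
Fresh-extend = mk⇔ (λ f → f ∘ suc , f zero) λ { (f , n) zero → n ; (f , n) (suc i) → f i }

IsInf-use : ∀ t (c : State k) s → IsInf (use t c s) → IsInf (c s)
IsInf-use t c s i with s ≟ t | c s
... | yes _ | inf = _
... | no _ | inf = _

-- Enumerating the states

branch : State k → State k → State (suc k)
branch c c' (true ∷ t) = c t
branch c c' (false ∷ t) = c' t

functions : ∀ k → List Cnt → List (State k)
functions zero l = map const l
functions (suc k) l = cartesianProductWith branch (functions k l) (functions k l)

-- A finite choice principle. It is stated for a relation rather than for membership, because a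
-- given function agrees with a listed one only pointwise.
functions-Any : ∀ {l} {R : Ty k → Cnt → Set} → (∀ t → Any (R t) l) → Any (λ c → ∀ t → R t (c t)) (functions k l)
functions-Any {zero} r = Any.map⁺ (Any.map (λ { x [] → x }) (r []))
functions-Any {suc k} r = Any.cartesianProductWith⁺ branch
  (λ { x y (true ∷ t) → x t ; x y (false ∷ t) → y t })
  (functions-Any (r ∘ (true ∷_))) (functions-Any (r ∘ (false ∷_)))

functions-All : ∀ {l} {R : Cnt → Set} → All R l → All (λ c → ∀ t → R (c t)) (functions k l)
functions-All {zero} r = All.map⁺ (All.map const r)
functions-All {suc k} r = All.cartesianProductWith⁺ (setoid _) (setoid _) branch _ _
  λ { x y (true ∷ t) → All.lookup (functions-All r) x t ; x y (false ∷ t) → All.lookup (functions-All r) y t }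

infs : Bool → List Cnt
infs b = if b then inf ∷ [] else []

-- Sizes below the rank `q` are kept exactly; all finite sizes from `q` on are merged.
counts : Logic → ℕ → List Cnt
counts L q = many q ∷ infs (allowsInf L) ++ applyUpTo exact q

Admissible : Logic → ℕ → Cnt → Set
Admissible L q x = Adequate q x × (IsInf x → IsTrue (allowsInf L))

counts-Admissible : ∀ L q → All (Admissible L q) (counts L q)
counts-Admissible L q = (≤-refl , λ ()) ∷ All.++⁺ (infinite (allowsInf L)) (All.applyUpTo⁺₂ exact q λ _ → _ , λ ())
  where
  infinite : ∀ b → All (λ x → Adequate q x × (IsInf x → IsTrue b)) (infs b)
  infinite true = _ ∷ []
  infinite false = []

states : Logic → ℕ → List (State k)
states L q = functions _ (counts L q)

states-Admissible : ∀ L q {c : State k} → c ∈L states L q → ∀ t → Admissible L q (c t)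
states-Admissible L q = All.lookup (functions-All (counts-Admissible L q))

-- The positive description of a state

IsTrue? : ∀ b → Dec (IsTrue b)
IsTrue? true = yes _
IsTrue? false = no λ ()

module Describe (L : Logic) (B : Subset k) where

  -- From t to the type of d in V, only predicates in B may grow.
  Above : Valuation k D → Ty k → D → Set
  Above V t d = ∀ a → (Vec.lookup t a ≡ true → V a d) × (¬ Vec.lookup t a ≡ true × a ∉ B → ¬ V a d)

  aboveAt : Ty k → Fin k → XF k (suc p)
  aboveAt t a = ((Vec.lookup t a Bool.≟ true) ⇒ₓ posₓ a zero)
    ∧ₓ ((¬? (Vec.lookup t a Bool.≟ true) ×-dec ¬? (a ∈? B)) ⇒ₓ negₓ a zero)

  above : Ty k → XF k (suc p)
  above t = ⋀ (aboveAt t) (allFin k)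

  oneAbove : {R : Ty k → Set} → (∀ t → Dec (R t)) → XF k (suc p)
  oneAbove R? = ⋁ (λ t → R? t &ₓ above t) (types k)

  -- To be asserted once `size` many elements of each type are drawn. The `many` classes have then
  -- met their minimum and only have to stay finite, which holds if all but finitely many elements
  -- can be sent to infinite types.
  restInf rest : State k → XF k p
  restInf c = allinfₓ (oneAbove (IsInf? ∘ c)) ∧ₓ ⋀ (λ t → IsInf? (c t) ⇒ₓ exinfₓ (above t)) (types k)
  rest c = allₓ (oneAbove (Open? ∘ c)) ∧ₓ (IsTrue? (allowsInf L) ⇒ₓ restInf c)

  -- The drawn elements are distinct without any inequality, because `exₓ` is exclusive.
  chain : List (Ty k) → State k → XF k p
  chain [] c = rest c
  chain (t ∷ w) c = exₓ (above t ∧ₓ chain w (use t c))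

  Rest : Valuation k D → (Fin p → D) → State k → Set
  Rest {D} V h c = (∀ d → Fresh h d → Σ (Ty k) λ t → Open (c t) × Above V t d)
    × (IsTrue (allowsInf L) →
         Finite (λ d → Fresh h d × ¬ Σ (Ty k) λ t → IsInf (c t) × Above V t d)
         × (∀ t → IsInf (c t) → ¬ Finite λ d → Fresh h d × Above V t d))

  module _ (V : Valuation k D) (h : Fin p → D) where

    above-⇔ : ∀ t d → ⟦ above t ⟧ₓ D V (extend d h) ⇔ Above V t d
    above-⇔ t d = ⇔-trans (⋀-Π (aboveAt t) ∈-allFin) (Π-⇔ λ a →
      ⇒ₓ-⇔ (Vec.lookup t a Bool.≟ true) (posₓ a zero) ×-⇔
      ⇒ₓ-⇔ (¬? (Vec.lookup t a Bool.≟ true) ×-dec ¬? (a ∈? B)) (negₓ a zero))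

    oneAbove-⇔ : {R : Ty k → Set} (R? : ∀ t → Dec (R t)) → ∀ d →
      ⟦ oneAbove R? ⟧ₓ D V (extend d h) ⇔ Σ (Ty k) λ t → R t × Above V t d
    oneAbove-⇔ R? d = ⇔-trans (⋁-Σ (λ t → R? t &ₓ above t) ∈-types)
      (Σ-⇔ λ t → ⇔-trans (&ₓ-⇔ (R? t) (above t)) (⇔-refl ×-⇔ above-⇔ t d))

    rest-⇔ : ∀ c → ⟦ rest c ⟧ₓ D V h ⇔ Rest V h c
    rest-⇔ c = (Π-⇔ λ d → →-⇔ λ _ → oneAbove-⇔ (Open? ∘ c) d)
      ×-⇔ ⇔-trans (⇒ₓ-⇔ (IsTrue? (allowsInf L)) (restInf c)) (→-⇔ λ _ →
        (Finite-⇔ λ d → ⇔-refl ×-⇔ ¬-cong-⇔ (oneAbove-⇔ (IsInf? ∘ c) d))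
        ×-⇔ ⇔-trans (⋀-Π (λ t → IsInf? (c t) ⇒ₓ exinfₓ (above t)) ∈-types)
          (Π-⇔ λ t → ⇔-trans (⇒ₓ-⇔ (IsInf? (c t)) (exinfₓ (above t))) (→-⇔ λ _ →
            ¬-cong-⇔ (Finite-⇔ λ d → ⇔-refl ×-⇔ above-⇔ t d))))

  above-Posₓ : ∀ t → Posₓ L B (above {p} t)
  above-Posₓ {p} t = ⋀-Posₓ L B (aboveAt {p} t) (λ a → ⇒ₓ-Posₓ (Vec.lookup t a Bool.≟ true) (posₓ {p = suc p} a zero) _
    , ⇒ₓ-Posₓ (¬? (Vec.lookup t a Bool.≟ true) ×-dec ¬? (a ∈? B)) (negₓ {p = suc p} a zero) proj₂) (allFin k)

  oneAbove-Posₓ : {R : Ty k → Set} (R? : ∀ t → Dec (R t)) → Posₓ L B (oneAbove {p} R?)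
  oneAbove-Posₓ R? = ⋁-Posₓ L B (λ t → R? t &ₓ above t) (λ t → &ₓ-Posₓ (R? t) (above t) (above-Posₓ t)) (types k)

  chain-Posₓ : ∀ w c → Posₓ L B (chain {p} w c)
  chain-Posₓ [] c = oneAbove-Posₓ (Open? ∘ c)
    , ⇒ₓ-Posₓ (IsTrue? (allowsInf L)) (restInf c) λ i → (i , oneAbove-Posₓ (IsInf? ∘ c))
      , ⋀-Posₓ L B (λ t → IsInf? (c t) ⇒ₓ exinfₓ (above t))
          (λ t → ⇒ₓ-Posₓ (IsInf? (c t)) (exinfₓ (above t)) λ _ → i , above-Posₓ t) (types k)
  chain-Posₓ (t ∷ w) c = above-Posₓ t , chain-Posₓ w (use t c)

-- The list of elements to be drawn for a state

count : Ty k → List (Ty k) → ℕ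
count t [] = 0
count t (s ∷ w) = if does (t ≟ s) then suc (count t w) else count t w

Drawn : List (Ty k) → State k → Set
Drawn w c = ∀ t → count t w ≡ size (c t)

size-dec : ∀ x → size (dec x) ≡ pred (size x)
size-dec (exact _) = refl
size-dec (many _) = refl
size-dec inf = refl

Drawn-head : ∀ (t : Ty k) w c → Drawn (t ∷ w) c → size (c t) ≡ suc (count t w)
Drawn-head t w c dr with t ≟ t | dr t
... | yes _ | e = sym e
... | no t≢t | _ = contradiction refl t≢t

Drawn-tail : ∀ (t : Ty k) w c → Drawn (t ∷ w) c → Drawn w (use t c)
Drawn-tail t w c dr s with s ≟ t | dr s
... | yes _ | e = trans (cong pred e) (sym (size-dec (c s)))
... | no _ | e = e

count-++ : ∀ (t : Ty k) v w → count t (v ++ w) ≡ count t v + count t w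
count-++ t [] w = refl
count-++ t (s ∷ v) w with t ≟ s
... | yes _ = cong suc (count-++ t v w)
... | no _ = count-++ t v w

count-replicate : ∀ m → count [] (replicate m []) ≡ m
count-replicate zero = refl
count-replicate (suc m) = cong suc (count-replicate m)

count-map : ∀ b b' (t : Ty k) w → count (b ∷ t) (map (b' ∷_) w) ≡ (if does (b Bool.≟ b') then count t w else 0)
count-map true true t [] = refl
count-map true false t [] = refl
count-map false true t [] = refl
count-map false false t [] = refl
count-map true true t (s ∷ w) with t ≟ s
... | yes _ = cong suc (count-map true true t w)
... | no _ = count-map true true t w
count-map true false t (s ∷ w) = count-map true false t w
count-map false true t (s ∷ w) = count-map false true t w
count-map false false t (s ∷ w) with t ≟ s
... | yes _ = cong suc (count-map false false t w)
... | no _ = count-map false false t w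

-- Recursion on the bits of a type, rather than a concatenation over `types k`, spares a proof that
-- `types k` has no repetitions.
draws : State k → List (Ty k)
draws {zero} c = replicate (size (c [])) []
draws {suc k} c = map (true ∷_) (draws (c ∘ (true ∷_))) ++ map (false ∷_) (draws (c ∘ (false ∷_)))

draws-Drawn : (c : State k) → Drawn (draws c) c
draws-Drawn {zero} c [] = count-replicate (size (c []))
draws-Drawn {suc k} c (b ∷ t) = trans
  (count-++ (b ∷ t) (map (true ∷_) (draws (c ∘ (true ∷_)))) _)
  (trans (cong₂ _+_ (count-map b true t (draws (c ∘ (true ∷_)))) (count-map b false t (draws (c ∘ (false ∷_))))) (halves b))
  where
  halves : ∀ b → (if does (b Bool.≟ true) then count t (draws (c ∘ (true ∷_))) else 0)
    + (if does (b Bool.≟ false) then count t (draws (c ∘ (false ∷_))) else 0) ≡ size (c (b ∷ t))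
  halves true = trans (+-identityʳ _) (draws-Drawn (c ∘ (true ∷_)) t)
  halves false = draws-Drawn (c ∘ (false ∷_)) t

-- The positivisation and the test for monotonicity

sentenceₓ : Sentence k → XF k 0
sentenceₓ φ = tr φ noVars

describe : Logic → Subset k → State k → XF k 0
describe L B c = Describe.chain L B (draws c) c

positivise : Logic → Subset k → Sentence k → XF k 0
positivise L B φ = ⋁ (λ c → Ev? (sentenceₓ φ) c noVars &ₓ describe L B c) (states L (rank (sentenceₓ φ)))

positivise-Posₓ : ∀ L (B : Subset k) φ → Posₓ L B (positivise L B φ)
positivise-Posₓ L B φ = ⋁-Posₓ L B (λ c → Ev? (sentenceₓ φ) c noVars &ₓ describe L B c)
  (λ c → &ₓ-Posₓ (Ev? (sentenceₓ φ) c noVars) (describe L B c)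
  (Describe.chain-Posₓ L B (draws c) c)) (states L (rank (sentenceₓ φ)))

-- The positivisation entails φ; the converse entailment always holds.
Collapses : Subset k → Sentence k → Set
Collapses B φ = All (λ c → Ev S c noVars → Ev (sentenceₓ φ) c noVars) (states MEinf (rank S + rank (sentenceₓ φ)))
  where S = positivise MEinf B φ

Collapses? : (B : Subset k) (φ : Sentence k) → Dec (Collapses B φ)
Collapses? B φ = all? (λ c → Ev? (positivise MEinf B φ) c noVars →-dec Ev? (sentenceₓ φ) c noVars) _

does-true : (x : Dec A) → does x ≡ true → A
does-true (yes x) _ = x

-- The fibres of the canonical model of a state `c`, whose domain is `Σ (Ty k) (Carrier ∘ c)` and
-- whose typing is the first projection. A `many m` class gets its least size.
Carrier : Cnt → Set
Carrier (exact m) = Fin m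
Carrier (many m) = Fin m
Carrier inf = ℕ

In-MEinf : ∀ L (φ : Fm k n) → In L φ → In MEinf φ
In-MEinf L tt i = _
In-MEinf L ff i = _
In-MEinf L (pos a x) i = _
In-MEinf L (neg a x) i = _
In-MEinf L (eq x y) i = _
In-MEinf L (neq x y) i = _
In-MEinf L (φ ∨' ψ) (i , j) = In-MEinf L φ i , In-MEinf L ψ j
In-MEinf L (φ ∧' ψ) (i , j) = In-MEinf L φ i , In-MEinf L ψ j
In-MEinf L (ex φ) i = In-MEinf L φ i
In-MEinf L (all φ) i = In-MEinf L φ i
In-MEinf L (exinf φ) (_ , i) = _ , In-MEinf L φ i
In-MEinf L (allinf φ) (_ , i) = _ , In-MEinf L φ i

-- Cycling through a list

nonEmpty : {a : A} {l : List A} → a ∈L l → NonZero (length l)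
nonEmpty a∈l = Fin.nonZeroIndex (index a∈l)

cycle : (l : List A) .{{_ : NonZero (length l)}} → ℕ → A
cycle l n = lookup l (n mod length l)

-- The time of the visit number `n`, counted from 0, that `cycle` pays to the position of `a`.
turn : {a : A} {l : List A} → a ∈L l → ℕ → ℕ
turn {l = l} a∈l n = toℕ (index a∈l) + n * length l

cycle-turn : {a : A} {l : List A} .{{_ : NonZero (length l)}} (a∈l : a ∈L l) → ∀ n → cycle l (turn a∈l n) ≡ a
cycle-turn {l = l} a∈l n = trans (cong (lookup l) (Fin.toℕ-injective (trans (Fin.toℕ-fromℕ< (m%n<n (turn a∈l n) (length l)))
  (trans ([m+kn]%n≡m%n (toℕ (index a∈l)) n (length l)) (m<n⇒m%n≡m (Fin.toℕ<n (index a∈l)))))))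
  (sym (Any.lookup-index a∈l))

turn-injective : {a : A} {l : List A} .{{_ : NonZero (length l)}} (a∈l : a ∈L l) → ∀ i j → turn a∈l i ≡ turn a∈l j → i ≡ j
turn-injective {l = l} a∈l i j e = *-cancelʳ-≡ i j (length l) (+-cancelˡ-≡ (toℕ (index a∈l)) _ _ e)

-- Correctness of the translations, by excluded middle

module Classical (em : ExcludedMiddle 0ℓ) where

  dne : ¬ ¬ A → A
  dne = decidable-stable em

  named? : (h : Fin p → D) (d : D) → (Σ (Fin p) λ i → h i ≡ d) ⊎ Fresh h d
  named? h d with em {Σ _ λ i → h i ≡ d}
  ... | yes x = inj₁ x
  ... | no ¬x = inj₂ λ i e → ¬x (i , e)

  -- Only finitely many elements are named. This is why `tr` treats named elements separately for
  -- `ex` and `all` but not for `exinf` and `allinf`.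
  Finite-Fresh : (h : Fin p → D) {P : D → Set} → Finite (λ d → Fresh h d × P d) → Finite P
  Finite-Fresh h {P} (l , c) = l ++ tabulate h , λ d x → [ (λ { (i , refl) → ∈-++⁺ʳ l (∈-tabulate⁺ i) })
    , (λ f → ∈-++⁺ˡ (c d (f , x))) ]′ (named? h d)

  -- Injectivity of `h` lets an equation between variables be decided from their names; exclusive
  -- quantifiers preserve it by `extend-Inj`.
  tr-⇔ : (φ : Fm k n) (ρ : Fin n → Fin p) {V : Valuation k D} {g : Fin n → D} {h : Fin p → D} →
    Inj h → (∀ x → g x ≡ h (ρ x)) → ⟦ φ ⟧ D V g ⇔ ⟦ tr φ ρ ⟧ₓ D V h
  tr-⇔ tt ρ inj e = ⇔-refl
  tr-⇔ ff ρ inj e = ⇔-refl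
  tr-⇔ (pos a x) ρ inj e rewrite e x = ⇔-refl
  tr-⇔ (neg a x) ρ inj e rewrite e x = ⇔-refl
  tr-⇔ (eq x y) ρ {h = h} inj e rewrite e x | e y =
    ⇔-trans (mk⇔ (λ q → inj _ _ q , _) (λ (q , _) → cong h q)) (⇔-sym (&ₓ-⇔ (ρ x Fin.≟ ρ y) ttₓ))
  tr-⇔ (neq x y) ρ {h = h} inj e rewrite e x | e y =
    ⇔-trans (¬-cong-⇔ (mk⇔ (inj _ _) (cong h))) (⇔-sym (⇒ₓ-⇔ (ρ x Fin.≟ ρ y) ffₓ))
  tr-⇔ (φ ∨' ψ) ρ inj e = tr-⇔ φ ρ inj e ⊎-⇔ tr-⇔ ψ ρ inj e
  tr-⇔ (φ ∧' ψ) ρ inj e = tr-⇔ φ ρ inj e ×-⇔ tr-⇔ ψ ρ inj e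
  tr-⇔ (ex φ) ρ {g = g} {h} inj e = ⇔-trans
    (mk⇔ (λ (d , x) → [ (λ { (i , refl) → inj₁ (i , to (tr-⇔ φ _ inj (named h ρ e i)) x) })
                      , (λ f → inj₂ (d , f , to (tr-⇔ φ _ (extend-Inj f inj) (fresh h ρ e d)) x)) ]′ (named? h d))
         [ (λ (i , x) → h i , from (tr-⇔ φ _ inj (named h ρ e i)) x)
         , (λ (d , f , x) → d , from (tr-⇔ φ _ (extend-Inj f inj) (fresh h ρ e d)) x) ]′)
    (⇔-sym (⋁-Σ _ ∈-allFin) ⊎-⇔ ⇔-refl)
  tr-⇔ (all φ) ρ {g = g} {h} inj e = ⇔-trans
    (mk⇔ (λ x → (λ i → to (tr-⇔ φ _ inj (named h ρ e i)) (x (h i)))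
              , (λ d f → to (tr-⇔ φ _ (extend-Inj f inj) (fresh h ρ e d)) (x d)))
         (λ (x , y) d → [ (λ { (i , refl) → from (tr-⇔ φ _ inj (named h ρ e i)) (x i) })
                        , (λ f → from (tr-⇔ φ _ (extend-Inj f inj) (fresh h ρ e d)) (y d f)) ]′ (named? h d)))
    (⇔-sym (⋀-Π _ ∈-allFin) ×-⇔ ⇔-refl)
  tr-⇔ (exinf φ) ρ {g = g} {h} inj e = ¬-cong-⇔ (⇔-trans
    (mk⇔ (Finite-⊆ λ _ → proj₂) (Finite-Fresh h))
    (Finite-⇔ λ d → ×ʳ-⇔ λ f → tr-⇔ φ _ (extend-Inj f inj) (fresh h ρ e d)))
  tr-⇔ (allinf φ) ρ {g = g} {h} inj e = ⇔-trans
    (mk⇔ (Finite-⊆ λ _ → proj₂) (Finite-Fresh h))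
    (Finite-⇔ λ d → ×ʳ-⇔ λ f → ¬-cong-⇔ (tr-⇔ φ _ (extend-Inj f inj) (fresh h ρ e d)))

  back-⇔ : (ξ : XF k p) {V : Valuation k D} (h : Fin p → D) → ⟦ ξ ⟧ₓ D V h ⇔ ⟦ back ξ ⟧ D V h
  back-⇔ ttₓ h = ⇔-refl
  back-⇔ ffₓ h = ⇔-refl
  back-⇔ (posₓ a x) h = ⇔-refl
  back-⇔ (negₓ a x) h = ⇔-refl
  back-⇔ (ξ ∨ₓ ζ) h = back-⇔ ξ h ⊎-⇔ back-⇔ ζ h
  back-⇔ (ξ ∧ₓ ζ) h = back-⇔ ξ h ×-⇔ back-⇔ ζ h
  back-⇔ (exₓ ξ) h = Σ-⇔ λ d → ⇔-sym (noneOf-⇔ id) ×-⇔ back-⇔ ξ (extend d h)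
  back-⇔ (allₓ ξ) h = Π-⇔ λ d → mk⇔
    (λ f → [ inj₁ ∘ from (oneOf-⇔ id) , inj₂ ∘ to (back-⇔ ξ _) ∘ f ]′ (named? h d))
    (λ x fr → [ (λ y → let i , e = to (oneOf-⇔ id) y in contradiction e (fr i)) , from (back-⇔ ξ _) ]′ x)
  back-⇔ (exinfₓ ξ) h = ¬-cong-⇔ (Finite-⇔ λ d → ⇔-sym (noneOf-⇔ id) ×-⇔ back-⇔ ξ (extend d h))
  back-⇔ (allinfₓ ξ) h = Finite-⇔ λ d → mk⇔
    (λ (fr , nx) → [ (λ y → let i , e = to (oneOf-⇔ id) y in fr i e) , nx ∘ from (back-⇔ ξ _) ]′)
    (λ n → (λ i e → n (inj₁ (from (oneOf-⇔ id) (i , e)))) , n ∘ inj₂ ∘ to (back-⇔ ξ _))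

  -- Pigeonhole: if a list shorter than `m` contained all values, two of them would share a
  -- position.
  injection-AtLeast : (f : Fin m → D) → Inj f → {P : D → Set} → (∀ i → P (f i)) → AtLeast m P
  injection-AtLeast f inj {P} q l lt = dne λ none →
    let covered = λ i → dne {A = f i ∈L l} λ f∉l → none (f i , q i , f∉l)
        i , j , i<j , e = Fin.pigeonhole lt (index ∘ covered)
    in Fin.<⇒≢ i<j (inj i j (trans (Any.lookup-index (covered i))
         (trans (cong (lookup l) e) (sym (Any.lookup-index (covered j))))))

  injection-infinite : (f : ℕ → D) → (∀ i j → f i ≡ f j → i ≡ j) → {P : D → Set} → (∀ i → P (f i)) → ¬ Finite P
  injection-infinite f inj {P} q (l , c) =
    let d , x , d∉l = injection-AtLeast (f ∘ toℕ) (λ i j → Fin.toℕ-injective ∘ inj _ _) {P} (q ∘ toℕ) l ≤-refl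
    in d∉l (c d x)

  -- Serves all four quantifiers of `flat-⇔`. With the empty predicate for `P`, it refutes that no
  -- copy of `d` is fresh, and so yields a fresh one.
  copies : (h : Fin p → D × ℕ) {P : D × ℕ → Set} (d : D) →
    (∀ m → Fresh h (d , m) → P (d , m)) → ¬ Finite (λ e → Fresh h e × P e)
  copies h {P} d q fin = injection-infinite (d ,_) (λ { i .i refl → refl }) {λ e → proj₁ e ≡ d} (λ _ → refl)
    (Finite-Fresh h (Finite-⊆ (λ { (_ , m) (f , refl) → f , q m f }) fin))

  flat-⇔ : (ξ : XF k p) {V : Valuation k D} {g : Fin p → D} {h : Fin p → D × ℕ} →
    (∀ x → proj₁ (h x) ≡ g x) → ⟦ ξ ⟧ₓ (D × ℕ) (blowup V) h ⇔ ⟦ flat ξ ⟧ D V g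
  flat-⇔ ttₓ e = ⇔-refl
  flat-⇔ ffₓ e = ⇔-refl
  flat-⇔ (posₓ a x) e rewrite e x = ⇔-refl
  flat-⇔ (negₓ a x) e rewrite e x = ⇔-refl
  flat-⇔ (ξ ∨ₓ ζ) e = flat-⇔ ξ e ⊎-⇔ flat-⇔ ζ e
  flat-⇔ (ξ ∧ₓ ζ) e = flat-⇔ ξ e ×-⇔ flat-⇔ ζ e
  flat-⇔ (exₓ ξ) {h = h} e = mk⇔
    (λ ((d , _) , _ , x) → d , to (flat-⇔ ξ λ { zero → refl ; (suc y) → e y }) x)
    (λ (d , x) → dne λ none → copies h d (λ m f → none ((d , m) , f , from (flat-⇔ ξ λ { zero → refl ; (suc y) → e y }) x))
      ([] , λ _ ()))
  flat-⇔ (allₓ ξ) {h = h} e = mk⇔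
    (λ x d → dne λ n → copies h d (λ m f → n (to (flat-⇔ ξ λ { zero → refl ; (suc y) → e y }) (x (d , m) f)))
      ([] , λ _ ()))
    (λ x (d , _) _ → from (flat-⇔ ξ λ { zero → refl ; (suc y) → e y }) (x d))
  flat-⇔ (exinfₓ ξ) {h = h} e = mk⇔
    (λ nf → dne λ none → nf ([] , λ (d , _) (_ , x) → contradiction (d , to (flat-⇔ ξ λ { zero → refl ; (suc y) → e y }) x) none))
    (λ (d , x) → copies h d λ m _ → from (flat-⇔ ξ λ { zero → refl ; (suc y) → e y }) x)
  flat-⇔ (allinfₓ ξ) {h = h} e = mk⇔
    (λ fin d → dne λ n → copies h d (λ m _ → n ∘ to (flat-⇔ ξ λ { zero → refl ; (suc y) → e y })) fin)
    (λ x → [] , λ (d , _) (_ , n) → contradiction (from (flat-⇔ ξ λ { zero → refl ; (suc y) → e y }) (x d)) n)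

  -- Counts when one more element is named

  module _ {L : Logic} {P Q : D → Set} {d : D} (Pd : P d) (Q⇔ : ∀ e → Q e ⇔ (P e × d ≢ e)) where

    Finite-remove : Finite Q → Finite P
    Finite-remove (l , c) = d ∷ l , λ e x → case em {d ≡ e} of λ where
      (yes refl) → here refl
      (no d≢e) → there (c e (from (Q⇔ e) (x , d≢e)))

    AtLeast-remove : AtLeast (suc m) P → AtLeast m Q
    AtLeast-remove al l lt = let e , x , e∉ = al (d ∷ l) (s≤s lt) in
      e , from (Q⇔ e) (x , λ d≡e → e∉ (here (sym d≡e))) , e∉ ∘ there

    -- Either the list misses `d`, which is then the witness, or deleting `d` makes the list short
    -- enough for `Q`.
    AtLeast-add : AtLeast m Q → AtLeast (suc m) P
    AtLeast-add al l lt with em {d ∈L l}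
    ... | no d∉l = d , Pd , d∉l
    ... | yes d∈l =
      let e , x , e∉ = al (l ─ d∈l) (≤-trans (≤-reflexive (sym (length-removeAt′ l (index d∈l)))) (s≤s⁻¹ lt))
          Pe , d≢e = to (Q⇔ e) x
      in e , Pe , λ e∈l → e∉ (∈-─ d∈l e∈l d≢e)

    HasCount-remove : ∀ x → HasCount L P x → HasCount L Q (dec x)
    HasCount-remove (exact zero) (_ , [] , _ , c) with () ← c d Pd
    HasCount-remove (exact (suc m)) (al , l , le , c) = AtLeast-remove al
      , (l ─ c d Pd) , s≤s⁻¹ (≤-trans (≤-reflexive (sym (length-removeAt′ l _))) le)
      , λ e x → let Pe , d≢e = to (Q⇔ e) x in ∈-─ (c d Pd) (c e Pe) d≢e
    HasCount-remove (many zero) (al , fin) = (λ _ ()) , Finite-⊆ (λ e → proj₁ ∘ to (Q⇔ e)) ∘ fin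
    HasCount-remove (many (suc m)) (al , fin) = AtLeast-remove al , Finite-⊆ (λ e → proj₁ ∘ to (Q⇔ e)) ∘ fin
    HasCount-remove inf nf = nf ∘ Finite-remove

    -- `dec` fixes `exact 0`, which cannot be the count of `P` since `d` satisfies it; the positive
    -- size excludes this case.
    HasCount-add : ∀ x → size x ≡ suc m → HasCount L Q (dec x) → HasCount L P x
    HasCount-add (exact (suc m)) _ (al , l , le , c) = AtLeast-add al , d ∷ l , s≤s le
      , proj₂ (Finite-remove (l , c))
    HasCount-add (many (suc m)) _ (al , fin) = AtLeast-add al , Finite-remove ∘ fin

  -- The doubtful case is `many 0`, which is `Present` but possibly empty. Adequacy for a positive
  -- rank, as available under a quantifier, rules it out.
  HasCount-inhabited : ∀ {L m} {P : D → Set} x → Adequate (suc m) x → HasCount L P x → Present x → Σ D P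
  HasCount-inhabited (exact (suc m)) _ (al , _) _ = map₂ proj₁ (al [] (s≤s z≤n))
  HasCount-inhabited (many (suc m)) _ (al , _) _ = map₂ proj₁ (al [] (s≤s z≤n))
  HasCount-inhabited inf _ nf _ = dne λ none → nf ([] , λ d x → contradiction (d , x) none)

  HasCount-finite : ∀ {L} {P : D → Set} x → IsTrue (allowsInf L) → HasCount L P x → ¬ IsInf x → Finite P
  HasCount-finite (exact m) i (_ , l , _ , c) _ = l , c
  HasCount-finite (many m) i (_ , fin) _ = fin i
  HasCount-finite inf i _ n = contradiction _ n

  HasCount-infinite : ∀ {L} {P : D → Set} x → HasCount L P x → IsInf x → ¬ Finite P
  HasCount-infinite inf nf _ = nf

  module _ {L : Logic} {h : Fin p → D} {τ : D → Ty k} {c : State k} {d : D} (fr : Fresh h d) where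

    private
      same : ∀ e → Class (extend d h) τ (τ d) e ⇔ (Class h τ (τ d) e × d ≢ e)
      same e = mk⇔ (λ (f , q) → (proj₁ (to Fresh-extend f) , q) , proj₂ (to Fresh-extend f))
                   (λ ((f , q) , n) → from Fresh-extend (f , n) , q)

      other : ∀ {s} → s ≢ τ d → ∀ e → Class (extend d h) τ s e ⇔ Class h τ s e
      other s≢ e = mk⇔ (λ (f , q) → proj₁ (to Fresh-extend f) , q)
                       (λ (f , q) → from Fresh-extend (f , λ { refl → s≢ (sym q) }) , q)

    Counts-use : Counts L h τ c → Counts L (extend d h) τ (use (τ d) c)
    Counts-use H s with s ≟ τ d
    ... | yes refl = HasCount-remove (fr , refl) same (c s) (H s)
    ... | no s≢ = HasCount-⇔ (λ e → ⇔-sym (other s≢ e)) (c s) (H s)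

    Counts-unuse : size (c (τ d)) ≡ suc m → Counts L (extend d h) τ (use (τ d) c) → Counts L h τ c
    Counts-unuse sz H s with s ≟ τ d | H s
    ... | yes refl | Hs = HasCount-add (fr , refl) same (c s) sz Hs
    ... | no s≢ | Hs = HasCount-⇔ (other s≢) (c s) Hs

  -- Truth depends only on the state

  Finite-⋃ : {Q : Ty k → D → Set} → (∀ t → Finite (Q t)) → Finite (λ d → Σ (Ty k) λ t → Q t d)
  Finite-⋃ fin = concatMap (proj₁ ∘ fin) (types _)
    , λ d (t , x) → ∈-concatMap⁺ (proj₁ ∘ fin) (lose (∈-types t) (proj₂ (fin t) d x))

  -- There are finitely many types, so an infinite set has infinitely many elements of one type; as
  -- `E` looks only at the type, the fresh elements of that type all belong to the set.
  Finite-Class : ∀ {L} {h : Fin p → D} {τ : D → Ty k} {c} → IsTrue (allowsInf L) → Counts L h τ c →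
    (E : Ty k → Set) → Finite (λ d → Fresh h d × E (τ d)) ⇔ (∀ t → IsInf (c t) → ¬ E t)
  Finite-Class {h = h} {τ} {c} i H E = mk⇔
    (λ fin t it Et → HasCount-infinite (c t) (H t) it (Finite-⊆ (λ { d (f , refl) → f , Et }) fin))
    (λ none → Finite-⊆ (λ d (f , x) → τ d , (f , refl) , x) (Finite-⋃ {Q = λ t d → Class h τ t d × E t} λ t →
      case IsInf? (c t) of λ where
        (yes it) → [] , λ d (_ , x) → contradiction x (none t it)
        (no nt) → Finite-⊆ (λ _ → proj₁) (HasCount-finite (c t) i (H t) nt)))

  -- Elements of one type are interchangeable, so a quantifier over elements becomes one over types.
  -- Naming an element takes it out of its class, as `use` records, and costs one unit of adequacy.
  Ev-⇔ : ∀ {L B} (ξ : XF k p) {V : Valuation k D} {τ : D → Ty k} {h : Fin p → D} {c ts} → Posₓ L B ξ →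
    (∀ t → Adequate (rank ξ) (c t)) → τ Types V → (∀ i → τ (h i) ≡ ts i) → Counts L h τ c →
    ⟦ ξ ⟧ₓ D V h ⇔ Ev ξ c ts
  Ev-⇔-extend : ∀ {L B} (ξ : XF k (suc p)) {V : Valuation k D} {τ : D → Ty k} {h : Fin p → D} {c ts} → Posₓ L B ξ →
    (∀ t → Adequate (suc (rank ξ)) (c t)) → τ Types V → (∀ i → τ (h i) ≡ ts i) → Counts L h τ c →
    ∀ d → Fresh h d → ⟦ ξ ⟧ₓ D V (extend d h) ⇔ Ev ξ (use (τ d) c) (extend (τ d) ts)

  Ev-⇔ ttₓ q ad ty e H = ⇔-refl
  Ev-⇔ ffₓ q ad ty e H = ⇔-refl
  Ev-⇔ (posₓ a x) {h = h} q ad ty e H rewrite sym (e x) = ty a (h x)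
  Ev-⇔ (negₓ a x) {h = h} q ad ty e H rewrite sym (e x) = ¬-cong-⇔ (ty a (h x))
  Ev-⇔ (ξ ∨ₓ ζ) {c = c} (q , r) ad ty e H =
    Ev-⇔ ξ q (λ t → Adequate-≤ (c t) (m≤m+n _ _) (ad t)) ty e H ⊎-⇔
    Ev-⇔ ζ r (λ t → Adequate-≤ (c t) (m≤n+m _ _) (ad t)) ty e H
  Ev-⇔ (ξ ∧ₓ ζ) {c = c} (q , r) ad ty e H =
    Ev-⇔ ξ q (λ t → Adequate-≤ (c t) (m≤m+n _ _) (ad t)) ty e H ×-⇔
    Ev-⇔ ζ r (λ t → Adequate-≤ (c t) (m≤n+m _ _) (ad t)) ty e H
  Ev-⇔ (exₓ ξ) {τ = τ} {c = c} q ad ty e H = mk⇔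
    (λ (d , f , x) → τ d , HasCount-Present (c (τ d)) (H (τ d)) (f , refl) , to (Ev-⇔-extend ξ q ad ty e H d f) x)
    λ (t , pr , x) → case HasCount-inhabited (c t) (ad t) (H t) pr of λ where
      (d , f , refl) → d , f , from (Ev-⇔-extend ξ q ad ty e H d f) x
  Ev-⇔ (allₓ ξ) {τ = τ} {c = c} q ad ty e H = mk⇔
    (λ x t pr → case HasCount-inhabited (c t) (ad t) (H t) pr of λ where
      (d , f , refl) → to (Ev-⇔-extend ξ q ad ty e H d f) (x d f))
    λ x d f → from (Ev-⇔-extend ξ q ad ty e H d f) (x (τ d) (HasCount-Present (c (τ d)) (H (τ d)) (f , refl)))
  Ev-⇔ (exinfₓ ξ) (i , q) ad ty e H = ⇔-trans
    (¬-cong-⇔ (⇔-trans (Finite-⇔ λ d → ×ʳ-⇔ (Ev-⇔-extend ξ q ad ty e H d)) (Finite-Class i H _)))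
    (mk⇔ (λ n → dne λ none → n λ t it x → none (t , it , x)) (λ (t , it , x) none → none t it x))
  Ev-⇔ (allinfₓ ξ) (i , q) ad ty e H = ⇔-trans
    (⇔-trans (Finite-⇔ λ d → ×ʳ-⇔ λ f → ¬-cong-⇔ (Ev-⇔-extend ξ q ad ty e H d f)) (Finite-Class i H _))
    (Π-⇔ λ t → →-⇔ λ _ → mk⇔ dne (λ x n → n x))

  Ev-⇔-extend ξ {c = c} q ad ty e H d f = Ev-⇔ ξ q (Adequate-use _ c ad) ty
    (λ { zero → refl ; (suc i) → e i }) (Counts-use f H)

  -- Every model has a listed state

  covered : {P : D → Set} → ¬ AtLeast (suc m) P → Σ (List D) λ l → length l ≤ m × (∀ d → P d → d ∈L l)
  covered n = dne λ none → n λ l lt → dne λ all∈ →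
    none (l , s≤s⁻¹ lt , λ d x → dne λ d∉l → all∈ (d , x , d∉l))

  -- At the first step where `AtLeast` fails, the failure supplies a covering list that makes the
  -- size exact.
  AtLeast⊎exact : ∀ L (P : D → Set) m → AtLeast m P ⊎ Σ ℕ λ i → i < m × HasCount L P (exact i)
  AtLeast⊎exact L P zero = inj₁ λ _ ()
  AtLeast⊎exact L P (suc m) with AtLeast⊎exact L P m | em {AtLeast (suc m) P}
  ... | inj₂ (i , i<m , H) | _ = inj₂ (i , m≤n⇒m≤1+n i<m , H)
  ... | inj₁ _ | yes al = inj₁ al
  ... | inj₁ al | no n = inj₂ (m , ≤-refl , al , covered n)

  counts-complete : ∀ L q (P : D → Set) → Any (HasCount L P) (counts L q)
  counts-complete L q P with AtLeast⊎exact L P q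
  ... | inj₂ (i , i<q , H) = there (Any.++⁺ʳ (infs (allowsInf L)) (Any.applyUpTo⁺ exact H i<q))
  ... | inj₁ al with em {IsTrue (allowsInf L) → Finite P}
  ...   | yes fin = here (al , fin)
  ...   | no n = there (Any.++⁺ˡ (infinite (allowsInf L) n))
    where
    infinite : ∀ b → ¬ (IsTrue b → Finite P) → Any (HasCount L P) (infs b)
    infinite true n = here λ fin → n λ _ → fin
    infinite false n = contradiction (λ ()) n

  states-complete : ∀ L q (τ : D → Ty k) → Any (Counts L noVars τ) (states L q)
  states-complete L q τ = functions-Any λ t → counts-complete L q (Class noVars τ t)

  typing : Valuation k D → D → Ty k
  typing V d = Vec.tabulate λ a → does (em {V a d})

  typing-Types : (V : Valuation k D) → typing V Types V
  typing-Types V a d rewrite Vec.lookup∘tabulate (λ a → does (em {V a d})) a with em {V a d}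
  ... | yes x = mk⇔ (λ _ → refl) (λ _ → x)
  ... | no n = mk⇔ (λ x → contradiction x n) (λ ())

  -- Pairwise disjoint infinite subsets of infinite sets Q t, chosen by a sequence
  -- that visits every type infinitely often and never repeats an element.
  module Split {Q : Ty k → D → Set} {I : Ty k → Set} (infinite : ∀ t → I t → ¬ Finite (Q t)) (start : Σ (Ty k) I) where

    -- A type outside `I` is replaced by `start`, so that at every time an element can be picked;
    -- the extra visits to `start` do no harm.
    visit : ℕ → Σ (Ty k) I
    visit i with em {I (cycle (types k) {{nonEmpty (∈-types (proj₁ start))}} i)}
    ... | yes x = _ , x
    ... | no _ = start

    returns : ∀ {t} → I t → ∀ n → proj₁ (visit (turn (∈-types t) n)) ≡ t
    returns {t} x n with em {I (cycle (types k) {{nonEmpty (∈-types (proj₁ start))}} (turn (∈-types t) n))}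
    ... | yes _ = cycle-turn {{nonEmpty (∈-types (proj₁ start))}} (∈-types t) n
    ... | no ¬x = contradiction (subst I (sym (cycle-turn {{nonEmpty (∈-types (proj₁ start))}} (∈-types t) n)) x) ¬x

    pick : ((t , _) : Σ (Ty k) I) (l : List D) → Σ D λ d → Q t d × d ∉L l
    pick (t , x) l = dne λ none → infinite t x (l , λ d q → dne λ d∉l → none (d , q , d∉l))

    history : ℕ → List D
    history zero = []
    history (suc n) = proj₁ (pick (visit n) (history n)) ∷ history n

    f : ℕ → D
    f n = proj₁ (pick (visit n) (history n))

    f∈history : ∀ {i n} → i < n → f i ∈L history n
    f∈history {n = suc n} (s≤s le) with m≤n⇒m<n∨m≡n le
    ... | inj₁ lt = there (f∈history lt)
    ... | inj₂ refl = here refl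

    f-injective : ∀ i j → f i ≡ f j → i ≡ j
    f-injective i j e with <-cmp i j
    ... | tri< lt _ _ = contradiction (subst (_∈L history j) e (f∈history lt)) (proj₂ (proj₂ (pick (visit j) (history j))))
    ... | tri≈ _ i≡j _ = i≡j
    ... | tri> _ _ gt = contradiction (subst (_∈L history i) (sym e) (f∈history gt)) (proj₂ (proj₂ (pick (visit i) (history i))))

    part : Ty k → D → Set
    part t d = Σ ℕ λ n → f n ≡ d × proj₁ (visit n) ≡ t

    part-⊆ : ∀ {t d} → part t d → I t × Q t d
    part-⊆ (n , refl , refl) = proj₂ (visit n) , proj₁ (proj₂ (pick (visit n) (history n)))

    part-disjoint : ∀ {s t d} → part s d → part t d → s ≡ t
    part-disjoint (i , refl , refl) (j , e , refl) = cong (proj₁ ∘ visit) (f-injective i j (sym e))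

    part-infinite : ∀ t → I t → ¬ Finite (part t)
    part-infinite t x = injection-infinite (f ∘ turn (∈-types t))
      (λ i j → turn-injective {{nonEmpty (∈-types (proj₁ start))}} (∈-types t) i j ∘ f-injective _ _)
      λ n → turn (∈-types t) n , refl , returns x n

  -- The sets `Q t` may overlap. Disjoint parts let each element be given a single type while every
  -- type in `I` keeps infinitely many.
  split : {Q : Ty k → D → Set} (I : Ty k → Set) → (∀ t → I t → ¬ Finite (Q t)) →
    Σ (Ty k → D → Set) λ part → (∀ {t d} → part t d → I t × Q t d)
      × (∀ {s t d} → part s d → part t d → s ≡ t) × (∀ t → I t → ¬ Finite (part t))
  split I infinite with em {Σ _ I}
  ... | yes start = let open Split infinite start in part , part-⊆ , part-disjoint , part-infinite
  ... | no none = (λ _ _ → Empty.⊥) , (λ ()) , (λ ()) , λ t x → contradiction (t , x) none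

  -- Descriptions hold exactly above models with the given state

  HasCount-size : ∀ {L} {P : D → Set} x → size x ≡ suc m → HasCount L P x → Σ D P
  HasCount-size x e H = HasCount-inhabited x (adequate x e) H (present x e)
    where
    adequate : ∀ x → size x ≡ suc m → Adequate 1 x
    adequate (exact _) e = _
    adequate (many (suc _)) e = s≤s z≤n
    present : ∀ x → size x ≡ suc m → Present x
    present (exact (suc _)) e = _
    present (many (suc _)) e = _

  size-Open : ∀ x → 0 ≡ size x → Present x → Open x
  size-Open (exact zero) refl ()
  size-Open (many _) e q = _
  size-Open inf e q = _

  module _ {L : Logic} {B : Subset k} where
    open Describe L B

    Types-Above : {V : Valuation k D} (τ : D → Ty k) → τ Types V → ∀ d → Above V (τ d) d
    Types-Above τ ty d a = from (ty a d) , λ (n , _) → n ∘ to (ty a d)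

    chain-complete : ∀ w {c} {V : Valuation k D} {τ : D → Ty k} {h : Fin p → D} → τ Types V →
      Drawn w c → Counts L h τ c → ⟦ chain w c ⟧ₓ D V h
    chain-complete [] {c} {V} {τ} {h} ty dr H = from (rest-⇔ V h c)
      ( (λ d f → τ d , size-Open (c (τ d)) (dr (τ d)) (HasCount-Present (c (τ d)) (H (τ d)) (f , refl)) , Types-Above τ ty d)
      , λ i → Finite-⊆ (λ d (f , n) → f , λ it → n (τ d , it , Types-Above τ ty d))
                (from (Finite-Class i H (λ t → ¬ IsInf (c t))) λ t it n → n it)
            , λ t it → HasCount-infinite (c t) (H t) it ∘ Finite-⊆ λ { d (f , refl) → f , Types-Above τ ty d })
    chain-complete (t ∷ w) {c} {V} {τ} {h} ty dr H with HasCount-size (c t) (Drawn-head t w c dr) (H t)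
    ... | d , f , refl = d , f , from (above-⇔ V h t d) (Types-Above τ ty d)
      , chain-complete w ty (Drawn-tail t w c dr) (Counts-use f H)

    Realisation : Valuation k D → (Fin p → D) → State k → Set
    Realisation {D} V h c = Σ (D → Ty k) λ τ → (∀ d → Fresh h d → Above V (τ d) d) × Counts L h τ c

    -- An element outside the parts goes to an infinite type whenever it lies above one, which
    -- leaves only finitely many for the `many` classes. The `exact` classes stay empty because
    -- fresh elements receive open types only.
    rest-sound : ∀ {c} {V : Valuation k D} {h : Fin p → D} → (∀ t → IsInf (c t) → IsTrue (allowsInf L)) →
      Drawn [] c → Rest V h c → Realisation V h c
    rest-sound {D} {c = c} {V} {h} ok dr (open′ , inf′)
      with split {Q = λ t d → Fresh h d × Above V t d} (IsInf ∘ c) (λ t it → proj₂ (inf′ (ok t it)) t it)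
    ... | part , part-⊆ , part-disjoint , part-infinite = τ , (λ d f → proj₁ (spec d) f) , counted
      where
      Spec : D → Ty k → Set
      Spec d t = (Fresh h d → Above V t d) × (Fresh h d → Open (c t))
        × (Fresh h d → (Σ (Ty k) λ s → IsInf (c s) × Above V s d) → IsInf (c t)) × (∀ s → part s d → t ≡ s)

      IsInf⇒Open : ∀ x → IsInf x → Open x
      IsInf⇒Open inf _ = _

      choose : ∀ d → Σ (Ty k) (Spec d)
      choose d with em {Σ (Ty k) λ s → part s d} | em {Σ (Ty k) λ s → IsInf (c s) × Above V s d} | em {Fresh h d}
      ... | yes (s , x) | _ | _ = let it , _ , ab = part-⊆ x in
        s , (λ _ → ab) , (λ _ → IsInf⇒Open (c s) it) , (λ _ _ → it) , λ _ → part-disjoint x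
      ... | no n | yes (s , it , ab) | _ =
        s , (λ _ → ab) , (λ _ → IsInf⇒Open (c s) it) , (λ _ _ → it) , λ s' y → contradiction (s' , y) n
      ... | no n | no n' | yes f = let t , o , ab = open′ d f in
        t , (λ _ → ab) , (λ _ → o) , (λ _ y → contradiction y n') , λ s' y → contradiction (s' , y) n
      -- Here `d` is already named and belongs to no class, so its type is a mere default.
      ... | no n | no n' | no n'' = ⊥ , (λ f → contradiction f n'') , (λ f → contradiction f n'')
        , (λ f → contradiction f n'') , λ s' y → contradiction (s' , y) n

      τ : D → Ty k
      τ = proj₁ ∘ choose

      spec : ∀ d → Spec d (τ d)
      spec = proj₂ ∘ choose

      counted : Counts L h τ c
      counted t with c t in e | dr t
      ... | exact .0 | refl = (λ _ ()) , [] , z≤n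
        , λ { d (f , refl) → contradiction (proj₁ (proj₂ (spec d)) f) (subst (¬_ ∘ Open) (sym e) λ ()) }
      ... | many .0 | refl = (λ _ ()) , λ i → Finite-⊆ (λ { d (f , refl) → f
        , λ y → subst IsInf e (proj₁ (proj₂ (proj₂ (spec d))) f y) }) (proj₁ (inf′ i))
      ... | inf | _ = part-infinite t (subst IsInf (sym e) _)
        ∘ Finite-⊆ λ d x → proj₁ (proj₂ (part-⊆ x)) , proj₂ (proj₂ (proj₂ (spec d))) t x

    -- For the recursive call `d` counts as named, so its type can be reset to `t` afterwards;
    -- putting `d` back into its class then undoes `use`.
    chain-sound : ∀ w {c} {V : Valuation k D} {h : Fin p → D} → (∀ t → IsInf (c t) → IsTrue (allowsInf L)) →
      Drawn w c → ⟦ chain w c ⟧ₓ D V h → Realisation V h c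
    chain-sound [] {c} {V} {h} ok dr x = rest-sound ok dr (to (rest-⇔ V h c) x)
    chain-sound {D} (t ∷ w) {c} {V} {h} ok dr (d , f , ab , x)
      with chain-sound w (λ s → ok s ∘ IsInf-use t c s) (Drawn-tail t w c dr) x
    ... | τ' , ab' , H = τ , above-τ , Counts-unuse f
        (subst (λ s → size (c s) ≡ suc (count t w)) (sym τd) (Drawn-head t w c dr))
        -- The classes over `extend d h` leave out `d`, the only element at which `τ` and `τ'` may
        -- differ.
        (subst (λ s → Counts L (extend d h) τ (use s c)) (sym τd) λ s → HasCount-⇔ (λ e → mk⇔
          (λ (g , y) → g , trans (τ-other (g zero)) y) (λ (g , y) → g , trans (sym (τ-other (g zero))) y)) _ (H s))
      where
      τ : D → Ty k
      τ e with em {d ≡ e}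
      ... | yes _ = t
      ... | no _ = τ' e

      τd : τ d ≡ t
      τd with em {d ≡ d}
      ... | yes _ = refl
      ... | no n = contradiction refl n

      τ-other : ∀ {e} → d ≢ e → τ e ≡ τ' e
      τ-other {e} d≢e with em {d ≡ e}
      ... | yes d≡e = contradiction d≡e d≢e
      ... | no _ = refl

      above-τ : ∀ e → Fresh h e → Above V (τ e) e
      above-τ e g with em {d ≡ e}
      ... | yes refl = to (above-⇔ V h t d) ab
      ... | no d≢e = ab' e (from Fresh-extend (g , d≢e))

  -- The characterisation of monotone sentences

  Val : (D → Ty k) → Valuation k D
  Val τ a d = Vec.lookup (τ d) a ≡ true

  Above-≤ : ∀ {L} {B : Subset k} {V : Valuation k D} τ → (∀ d → Describe.Above L B V (τ d) d) → Val τ ≤[ B ] V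
  Above-≤ τ ab = (λ b _ d → proj₁ (ab d b)) , λ a a∉B d → proj₁ (ab d a) ,
    λ x → decidable-stable (Vec.lookup (τ d) a Bool.≟ true) λ n → proj₂ (ab d a) (n , a∉B) x

  sentenceₓ-⇔ : (φ : Sentence k) (V : Valuation k D) → ⟦ φ ⟧ D V noVars ⇔ ⟦ sentenceₓ φ ⟧ₓ D V noVars
  sentenceₓ-⇔ φ V = tr-⇔ φ noVars (λ ()) (λ ())

  Ev-sentenceₓ : ∀ {L} (φ : Sentence k) {c} {V : Valuation k D} {τ : D → Ty k} → In L φ →
    (∀ t → Adequate (rank (sentenceₓ φ)) (c t)) → τ Types V → Counts L noVars τ c →
    ⟦ φ ⟧ D V noVars ⇔ Ev (sentenceₓ φ) c noVars
  Ev-sentenceₓ φ i ad ty H =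
    ⇔-trans (sentenceₓ-⇔ φ _) (Ev-⇔ (sentenceₓ φ) (tr-Posₓ φ noVars i) ad ty (λ ()) H)

  module _ {L : Logic} (B : Subset k) (φ : Sentence k) (i : In L φ) where

    private
      q = rank (sentenceₓ φ)

      adequate : {c : State k} → c ∈L states L q → ∀ t → Adequate q (c t)
      adequate c∈ t = proj₁ (states-Admissible L q c∈ t)

    positivise-complete : (V : Valuation k D) → ⟦ φ ⟧ D V noVars → ⟦ positivise L B φ ⟧ₓ D V noVars
    positivise-complete V x with find (states-complete L q (typing V))
    ... | c , c∈ , H = from (⋁-Any (λ c → Ev? (sentenceₓ φ) c noVars &ₓ describe L B c) _) (lose c∈
      (from (&ₓ-⇔ (Ev? (sentenceₓ φ) c noVars) (describe L B c))
        (to (Ev-sentenceₓ φ i (adequate c∈) (typing-Types V) H) x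
        , chain-complete (draws c) (typing-Types V) (draws-Drawn c) H)))

    positivise-sound : Monotone B φ → (V : Valuation k D) → ⟦ positivise L B φ ⟧ₓ D V noVars → ⟦ φ ⟧ D V noVars
    positivise-sound mono V x
      with find (to (⋁-Any (λ c → Ev? (sentenceₓ φ) c noVars &ₓ describe L B c) (states L q)) x)
    ... | c , c∈ , y with to (&ₓ-⇔ (Ev? (sentenceₓ φ) c noVars) (describe L B c)) y
    ... | ev , z with chain-sound (draws c) (λ t → proj₂ (states-Admissible L q c∈ t)) (draws-Drawn c) z
    -- No element is named, so freshness is vacuous and `τ` lies below `V` on the whole domain.
    ... | τ , ab , H = mono _ (Val τ) V noVars (Above-≤ {L = L} τ λ d → ab d λ ())
      (from (Ev-sentenceₓ φ i (adequate c∈) (λ _ _ → ⇔-refl) H) ev)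

    positivise-⇔ : Monotone B φ → (V : Valuation k D) → ⟦ φ ⟧ D V noVars ⇔ ⟦ positivise L B φ ⟧ₓ D V noVars
    positivise-⇔ mono V = mk⇔ (positivise-complete V) (positivise-sound mono V)

    back-equivalent : Monotone B φ → Equivalent φ (back (positivise L B φ))
    back-equivalent mono D V = to e , from e
      where e = ⇔-trans (positivise-⇔ mono V) (back-⇔ (positivise L B φ) noVars)

    flat-equivalent : In M φ → Monotone B φ → Equivalent φ (flat (positivise L B φ))
    flat-equivalent j mono D V = to e , from e
      where e = ⇔-trans (⇔-sym (blowup-⇔ φ j λ ())) (⇔-trans (positivise-⇔ mono (blowup V))
                  (flat-⇔ (positivise L B φ) λ ()))

  characterise : ∀ L (B : Subset k) φ → In L φ → Monotone B φ → Σ (Sentence k) λ ψ → Positive L B ψ × Equivalent φ ψ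
  characterise M B φ i mono = flat (positivise MEinf B φ)
    , flat-Positive (positivise MEinf B φ) (positivise-Posₓ MEinf B φ)
    , flat-equivalent B φ (In-MEinf M φ i) i mono
  characterise ME B φ i mono = back (positivise ME B φ)
    , back-Positive _ (positivise ME B φ) (positivise-Posₓ ME B φ) , back-equivalent B φ i mono
  characterise MEinf B φ i mono = back (positivise MEinf B φ)
    , back-Positive _ (positivise MEinf B φ) (positivise-Posₓ MEinf B φ) , back-equivalent B φ i mono

  -- Correctness of the test

  Carrier-HasCount : ∀ {L} x (f : Carrier x → D) → (∀ i j → f i ≡ f j → i ≡ j) → {P : D → Set} →
    (∀ i → P (f i)) → (∀ d → P d → Σ (Carrier x) λ i → f i ≡ d) → HasCount L P x
  Carrier-HasCount (exact m) f inj q onto = injection-AtLeast f inj q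
    , tabulate f , ≤-reflexive (length-tabulate f) , λ d x → case onto d x of λ { (i , refl) → ∈-tabulate⁺ i }
  Carrier-HasCount (many m) f inj q onto = injection-AtLeast f inj q
    , λ _ → tabulate f , λ d x → case onto d x of λ { (i , refl) → ∈-tabulate⁺ i }
  Carrier-HasCount inf f inj q onto = injection-infinite f inj q

  canonical-Counts : ∀ {L} (c : State k) → Counts L noVars (proj₁ {B = Carrier ∘ c}) c
  canonical-Counts c t = Carrier-HasCount (c t) (t ,_) (λ { i .i refl → refl }) (λ _ → (λ ()) , refl)
    λ { (.t , i) (_ , refl) → i , refl }

  module _ (B : Subset k) (φ : Sentence k) (i : In MEinf φ) where

    private
      S = positivise MEinf B φ
      q = rank S + rank (sentenceₓ φ)

      Ev-S : ∀ {c} {V : Valuation k D} {τ : D → Ty k} → c ∈L states MEinf q → τ Types V → Counts MEinf noVars τ c →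
        ⟦ S ⟧ₓ D V noVars ⇔ Ev S c noVars
      Ev-S {c = c} c∈ ty H = Ev-⇔ S (positivise-Posₓ MEinf B φ)
        (λ t → Adequate-≤ (c t) (m≤m+n _ _) (proj₁ (states-Admissible MEinf q c∈ t))) ty (λ ()) H

      Ev-φ : ∀ {c} {V : Valuation k D} {τ : D → Ty k} → c ∈L states MEinf q → τ Types V → Counts MEinf noVars τ c →
        ⟦ φ ⟧ D V noVars ⇔ Ev (sentenceₓ φ) c noVars
      Ev-φ {c = c} c∈ = Ev-sentenceₓ φ i λ t →
        Adequate-≤ (c t) (m≤n+m _ (rank S)) (proj₁ (states-Admissible MEinf q c∈ t))

    -- Every model has one of the listed states, and that state settles both sentences; so the
    -- finite check makes `φ` equivalent to the positive `back S`.
    Collapses-monotone : Collapses B φ → Monotone B φ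
    Collapses-monotone col = monotone-sentence φ (back S) equivalent
      (positive-monotone (back-Positive _ S (positivise-Posₓ MEinf B φ)))
      where
      equivalent : Equivalent φ (back S)
      equivalent D V = to (back-⇔ S noVars) ∘ positivise-complete B φ i V , λ x →
        let c , c∈ , H = find (states-complete MEinf q (typing V))
        in from (Ev-φ c∈ (typing-Types V) H) (All.lookup col c∈
             (to (Ev-S c∈ (typing-Types V) H) (from (back-⇔ S noVars) x)))

    -- Each listed state occurs in an actual model, the canonical one, so the entailment between the
    -- sentences carries over to states.
    monotone-Collapses : Monotone B φ → Collapses B φ
    monotone-Collapses mono = All.tabulate λ {c} c∈ ev →
      let V = Val (proj₁ {B = Carrier ∘ c})
      in to (Ev-φ {V = V} c∈ (λ _ _ → ⇔-refl) (canonical-Counts c))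
           (positivise-sound B φ i mono V (from (Ev-S c∈ (λ _ _ → ⇔-refl) (canonical-Counts c)) ev))

theorem4p4 : (k : ℕ) →
    (ExcludedMiddle 0ℓ → (L : Logic) (B : Subset k) (φ : Sentence k) → In L φ →
    (Monotone B φ → Σ (Sentence k) (λ ψ → Positive L B ψ × Equivalent φ ψ))
    × (Σ (Sentence k) (λ ψ → Positive L B ψ × Equivalent φ ψ) → Monotone B φ))
    × Σ (Logic → Subset k → Sentence k → Bool) (λ decide →
    ExcludedMiddle 0ℓ → (L : Logic) (B : Subset k) (φ : Sentence k) → In L φ →
    (decide L B φ ≡ true → Monotone B φ) × (Monotone B φ → decide L B φ ≡ true))
theorem4p4 k =
  (λ em L B φ i → Classical.characterise em L B φ i , λ (ψ , q , e) → monotone-sentence φ ψ e (positive-monotone q))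
  -- The answer is the same for every `L`, since each sentence is also one of ME^∞ with the same
  -- models.
  , (λ L B φ → does (Collapses? B φ))
  , λ em L B φ i → (λ e → Classical.Collapses-monotone em B φ (In-MEinf L φ i) (does-true (Collapses? B φ) e))
                 , λ mono → dec-true (Collapses? B φ) (Classical.monotone-Collapses em B φ (In-MEinf L φ i) mono)
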